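{- Let $X\subset\mathbb R^n\setminus\{0\}$ be a finite set such that $0$ lies in the interior of the convex hull of $X$, no element of $X$ is a positive multiple of another element of $X$, and no $n+1$ points of $X$ are in conical position. Then $X$ contains some $k\ge 1$ pairwise disjoint subsets $X_1,\dots,X_k$ such that (i) each $X_i$ is the vertex set of a simplex whose relative interior contains $0$, (ii) the linear spaces spanned by the $X_i$ are linearly independent, and (iii) these linear spaces sum (directly) to $\mathbb R^n$.
   Context: A set of points is in conical position if $0$ is not in its convex hull (i.e. some hyperplane strictly separates the set from $0$) and none of its points lies in the positive hull (set of nonnegative linear combinations) of the others. A collection $X_1,\dots,X_k$ as in the conclusion is called a skeleton of $X$. -}

module Defs where

open import Level using (Level; _⊔_) renaming (suc to lsuc)
open import Data.Nat using (ℕ; zero; suc)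
import Data.Nat
open import Data.Fin using (Fin; zero; suc)
open import Data.Fin.Subset using (Subset; _∈_; _∉_; ∣_∣; outside)
open import Data.Vec using (_[_]≔_)
open import Data.Product using (Σ; _×_; ∃; ∃-syntax; _,_)
open import Relation.Nullary using (¬_)
open import Relation.Binary.PropositionalEquality using (_≡_; _≢_)
open import Algebra.Bundles using (CommutativeRing)
open import Relation.Binary.Structures using (IsStrictTotalOrder)

record OrderedField (c ℓ₁ ℓ₂ : Level) : Set (lsuc (c ⊔ ℓ₁ ⊔ ℓ₂)) where
  field
    commRing : CommutativeRing c ℓ₁
  open CommutativeRing commRing public
  field
    _<_                : Carrier → Carrier → Set ℓ₂
    isStrictTotalOrder : IsStrictTotalOrder _≈_ _<_
    1≉0     : ¬ (1# ≈ 0#)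
    inverse : ∀ x → ¬ (x ≈ 0#) → ∃[ y ] (x * y ≈ 1#)
    +-mono-< : ∀ {x y} z → x < y → (x + z) < (y + z)
    *-pos    : ∀ {x y} → 0# < x → 0# < y → 0# < (x * y)

  _≤_ : Carrier → Carrier → Set (ℓ₁ ⊔ ℓ₂)
  x ≤ y = (x < y) Data.Sum.⊎ (x ≈ y)
    where import Data.Sum

module _ {c ℓ₁ ℓ₂ : Level} (F : OrderedField c ℓ₁ ℓ₂) where
  open OrderedField F using (Carrier; _≈_; _+_; _*_; -_; 0#; 1#; _<_; _≤_)

  Vect : ℕ → Set c
  Vect n = Fin n → Carrier

  _≈ᵥ_ : ∀ {n} → Vect n → Vect n → Set ℓ₁
  u ≈ᵥ v = ∀ j → u j ≈ v j

  zeroV : ∀ {n} → Vect n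
  zeroV _ = 0#

  _·_ : ∀ {n} → Carrier → Vect n → Vect n
  (t · v) j = t * v j

  Σs : ∀ {m} → (Fin m → Carrier) → Carrier
  Σs {zero}  f = 0#
  Σs {suc m} f = f zero + Σs (λ i → f (suc i))

  Σv : ∀ {n k} → (Fin k → Vect n) → Vect n
  Σv v j = Σs (λ i → v i j)

  lincomb : ∀ {n m} → (Fin m → Vect n) → (Fin m → Carrier) → Vect n
  lincomb X λc = Σv (λ i → λc i · X i)

  SupportedOn : ∀ {m} → Subset m → (Fin m → Carrier) → Set ℓ₁
  SupportedOn S λc = ∀ i → i ∉ S → λc i ≈ 0#

  InConvexHull : ∀ {n m} → (Fin m → Vect n) → Subset m → Vect n → Set (c ⊔ ℓ₁ ⊔ ℓ₂)
  InConvexHull X S y = ∃[ λc ] (SupportedOn S λc × (∀ i → 0# ≤ λc i)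
                                 × (Σs λc ≈ 1#) × (lincomb X λc ≈ᵥ y))

  InPositiveHull : ∀ {n m} → (Fin m → Vect n) → Subset m → Vect n → Set (c ⊔ ℓ₁ ⊔ ℓ₂)
  InPositiveHull X S y = ∃[ λc ] (SupportedOn S λc × (∀ i → 0# ≤ λc i)
                                   × (lincomb X λc ≈ᵥ y))

  InSpan : ∀ {n m} → (Fin m → Vect n) → Subset m → Vect n → Set (c ⊔ ℓ₁)
  InSpan X S y = ∃[ λc ] (SupportedOn S λc × (lincomb X λc ≈ᵥ y))

  -- 0 lies in the interior of the convex hull of all of X
  -- (interior w.r.t. the product order topology on F^n: some open box around 0)
  ZeroInInteriorConvHull : ∀ {n m} → (Fin m → Vect n) → Set (c ⊔ ℓ₁ ⊔ ℓ₂)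
  ZeroInInteriorConvHull {n} {m} X =
    ∃[ ε ] ((0# < ε) × (∀ (y : Vect n) → (∀ j → ((- ε) < y j) × (y j < ε))
                         → InConvexHull X (Data.Vec.replicate m Data.Fin.Subset.inside) y))
    where import Data.Vec

  ConicalPosition : ∀ {n m} → (Fin m → Vect n) → Subset m → Set (c ⊔ ℓ₁ ⊔ ℓ₂)
  ConicalPosition X S =
    ¬ InConvexHull X S zeroV
    × (∀ i → i ∈ S → ¬ InPositiveHull X (S [ i ]≔ outside) (X i))

  AffinelyIndependent : ∀ {n m} → (Fin m → Vect n) → Subset m → Set (c ⊔ ℓ₁)
  AffinelyIndependent X S =
    ∀ λc → SupportedOn S λc → Σs λc ≈ 0# → lincomb X λc ≈ᵥ zeroV → ∀ i → λc i ≈ 0#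

  -- {X_i : i ∈ S} is the vertex set of a simplex whose relative interior
  -- contains 0 (relative interior of a simplex = strictly positive
  -- barycentric coordinates)
  SimplexWith0InRelint : ∀ {n m} → (Fin m → Vect n) → Subset m → Set (c ⊔ ℓ₁ ⊔ ℓ₂)
  SimplexWith0InRelint X S =
    AffinelyIndependent X S
    × ∃[ λc ] (SupportedOn S λc × (∀ i → i ∈ S → 0# < λc i)
               × (Σs λc ≈ 1#) × (lincomb X λc ≈ᵥ zeroV))

  record Hypotheses {n m : ℕ} (X : Fin m → Vect n) : Set (c ⊔ ℓ₁ ⊔ ℓ₂) where
    field
      nonzero      : ∀ i → ¬ (X i ≈ᵥ zeroV)
      interior     : ZeroInInteriorConvHull X
      noPosMultiple : ∀ i j → i ≢ j → ¬ (∃[ t ] ((0# < t) × (X i ≈ᵥ (t · X j))))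
      noConical    : ∀ (S : Subset m) → ∣ S ∣ ≡ suc n → ¬ ConicalPosition X S

  record Skeleton {n m : ℕ} (X : Fin m → Vect n) (k : ℕ) (Y : Fin k → Subset m)
         : Set (c ⊔ ℓ₁ ⊔ ℓ₂) where
    field
      k≥1        : Data.Nat._≤_ 1 k
      disjoint   : ∀ a b → a ≢ b → ∀ i → i ∈ Y a → i ∉ Y b
      simplices  : ∀ a → SimplexWith0InRelint X (Y a)
      independent : ∀ (v : Fin k → Vect n) → (∀ a → InSpan X (Y a) (v a))
                    → Σv v ≈ᵥ zeroV → ∀ a → v a ≈ᵥ zeroV
      spanning   : ∀ (y : Vect n) → ∃[ v ] ((∀ a → InSpan X (Y a) (v a)) × (Σv v ≈ᵥ y))

{-# OPTIONS --safe #-}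
module Submission where

-- Only the linear dependencies of X matter, up to sign. A circuit (support-minimal dependency)
-- with at least two positive and two negative coefficients extends to n + 1 points having no
-- other dependency, and those are in conical position; so X has no such bad circuit. Since 0 is
-- interior to the hull, X also has a strictly positive dependency. Both properties pass to the
-- contraction of X by its first point x ≠ 0, and to X without x if x is in the cone of the others.
-- So take by induction a skeleton X₁, …, X_k modulo x, in which Σ λᵢ Xᵢ ∈ ℝ x for each block.
--   * If some block sums to a positive multiple of x, then x can be deleted.
--   * If exactly one block sums to a negative multiple of x, it absorbs x; two such blocks would
--     carry a bad circuit.
--   * If all blocks sum to 0, some y lies strictly on the other side of their span from x.
--     Write a positive multiple of -x as y + Σ ζⱼ xⱼ with ζ ≥ 0 vanishing somewhere on each block.
--     If ζ ≠ 0 on a block then it vanishes at exactly one point of it, again by the absence of bad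
--     circuits. Then x, y and the support of ζ form a new block, replacing those it meets.

open import Defs
open import Level using (Level; _⊔_)
open import Data.Nat using (ℕ)
open import Data.Fin using (Fin)
open import Data.Fin.Subset using (Subset)
open import Data.Product using (∃-syntax)

open import Data.Nat as ℕ using (zero; suc)
import Data.Nat.Properties as ℕ
open import Data.Integer as ℤ using (ℤ; +_; -[1+_])
import Data.Integer.Properties as ℤ
open import Data.Fin using (zero; suc)
open import Data.Fin.Properties using (_≟_; any?; suc-injective)
open import Data.Fin.Subset using (Nonempty; inside; outside; _∈_; _∉_; ∣_∣)
import Data.Fin.Subset as Subset
open import Data.Fin.Subset.Properties
  using (_∈?_; nonempty?; Empty-unique; ∣⊥∣≡0; ∣⊤∣≡n; drop-not-there)
open import Data.Vec as Vec using (_[_]≔_; here; there; tabulate)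
open import Data.Vec.Properties
  using ([]≔-minimal; []=⇒lookup; lookup⇒[]=; lookup∘tabulate; lookup∘update; lookup∘update′)
open import Data.Vec.Functional using (_∷_)
open import Data.Empty using (⊥; ⊥-elim)
open import Data.Maybe using (Maybe; just; nothing)
open import Data.Product using (Σ; _×_; _,_; proj₁; proj₂)
open import Data.Sum using (_⊎_; inj₁; inj₂; [_,_]′)
open import Function using (_∘_)
open import Relation.Nullary using (¬_; Dec; yes; no; does; contradiction)
open import Relation.Nullary.Decidable using (_×-dec_; ¬?; decidable-stable; dec-true)
open import Relation.Unary using (Decidable)
open import Relation.Binary.PropositionalEquality as ≡ using (_≡_; _≢_)
open import Relation.Binary.Structures using (IsStrictTotalOrder)
open import Relation.Binary.Definitions using (tri<; tri≈; tri>)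

-- Why two coefficients of each sign: `0` in the convex hull is a dependency with no negative
-- coefficient, and a point in the positive hull of others is a dependency with exactly one. If all
-- dependencies of a set are multiples of a single one with two coefficients of each sign, then
-- every nonzero one has at least two negative coefficients, so neither can occur.
--
-- The induction needs a condition that survives contraction. Conical position of `n + 1` points is
-- tied to the dimension, whereas a circuit of the contraction lifts to a circuit with the same
-- signs on the surviving points. So conical position is traded for circuits once, before the
-- induction.
--
-- In the last case the danger is that the span shrinks: a block met by the new circuit loses the
-- points where ζ vanishes. Such a block has a single dependency, which can recover a single lost
-- point; hence the need for exactly one zero. The point y comes from the positive dependency:
-- modulo the span of the blocks it is a vanishing weighted sum of coordinates along x, to which x
-- itself contributes a positive term.

private variable n : ℕ

-- Finite subsets: cardinality, membership, enumeration

∣∣>0⇒Nonempty : (S : Subset n) → 0 ℕ.< ∣ S ∣ → Nonempty S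
∣∣>0⇒Nonempty {n} S p with nonempty? S
... | yes q = q
... | no q = ⊥-elim (ℕ.<-irrefl ≡.refl (≡.subst (0 ℕ.<_) (≡.trans (≡.cong ∣_∣ (Empty-unique q)) (∣⊥∣≡0 n)) p))

∣remove∣ : ∀ {S : Subset n} {p} → p ∈ S → ∣ S ∣ ≡ suc ∣ S [ p ]≔ outside ∣
∣remove∣ here = ≡.refl
∣remove∣ {S = inside Vec.∷ S} (there p∈S) = ≡.cong suc (∣remove∣ p∈S)
∣remove∣ {S = outside Vec.∷ S} (there p∈S) = ∣remove∣ p∈S

∣insert∣ : ∀ (S : Subset n) p → p ∉ S → ∣ S [ p ]≔ inside ∣ ≡ suc ∣ S ∣
∣insert∣ (inside Vec.∷ S) zero p∉S = ⊥-elim (p∉S here)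
∣insert∣ (outside Vec.∷ S) zero p∉S = ≡.refl
∣insert∣ (inside Vec.∷ S) (suc p) p∉S = ≡.cong suc (∣insert∣ S p (drop-not-there p∉S))
∣insert∣ (outside Vec.∷ S) (suc p) p∉S = ∣insert∣ S p (drop-not-there p∉S)

∉-remove : ∀ (S : Subset n) p → p ∉ S [ p ]≔ outside
∉-remove S p p∈ with ≡.trans (≡.sym ([]=⇒lookup p∈)) (lookup∘update p S outside)
... | ()

∉-remove⁺ : ∀ {S : Subset n} {p q} → q ∉ S → q ∉ S [ p ]≔ outside
∉-remove⁺ {S = S} {p} {q} q∉S q∈ with q ≟ p
... | yes ≡.refl = ∉-remove S p q∈
... | no q≢p = q∉S (lookup⇒[]= q S (≡.trans (≡.sym (lookup∘update′ q≢p S outside)) ([]=⇒lookup q∈)))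

∈-update⁻ : ∀ {S : Subset n} {p q s} → q ≢ p → q ∈ S [ p ]≔ s → q ∈ S
∈-update⁻ {S = S} {q = q} {s} q≢p q∈ =
  lookup⇒[]= q S (≡.trans (≡.sym (lookup∘update′ q≢p S s)) ([]=⇒lookup q∈))

∉-remove⁻ : ∀ {S : Subset n} {p q} → q ≢ p → q ∉ S [ p ]≔ outside → q ∉ S
∉-remove⁻ {S = S} {p} {q} q≢p q∉ q∈S = q∉ ([]≔-minimal S q p q≢p q∈S)

-- Surjectivity onto `S` from an index type of size `∣ S ∣` is all that counting equations requires.
enumerate : (S : Subset n) → Σ (Fin ∣ S ∣ → Fin n) λ e → ∀ {i} → i ∈ S → ∃[ k ] (e k ≡ i)
enumerate Vec.[] = (λ ()) , λ { {()} }
enumerate (inside Vec.∷ S) with enumerate S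
... | e , hits = (λ { zero → zero ; (suc k) → suc (e k) }) , λ
  { here → zero , ≡.refl
  ; (there i∈S) → let k , eq = hits i∈S in suc k , ≡.cong suc eq }
enumerate (outside Vec.∷ S) with enumerate S
... | e , hits = (λ k → suc (e k)) , λ { (there i∈S) → let k , eq = hits i∈S in k , ≡.cong suc eq }

module _ {p} {P : Fin n → Set p} (P? : Decidable P) where

  comprehension : Subset n
  comprehension = tabulate (λ i → does (P? i))

  ∈-comprehension⁺ : ∀ {i} → P i → i ∈ comprehension
  ∈-comprehension⁺ {i} Pi = lookup⇒[]= i _ (≡.trans (lookup∘tabulate _ i) (dec-true (P? i) Pi))

  ∈-comprehension⁻ : ∀ {i} → i ∈ comprehension → P i
  ∈-comprehension⁻ {i} i∈ with P? i | ≡.trans (≡.sym (lookup∘tabulate (λ i → does (P? i)) i)) ([]=⇒lookup i∈)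
  ... | yes Pi | _ = Pi
  ... | no _ | ()

-- Serves to renumber the labels that name a block: labels range over `Fin m`, while the blocks of a
-- skeleton are indexed by `Fin k`.
select : ∀ {p} {P : Fin n → Set p} → Decidable P → ∃[ k ] Σ (Fin k → Fin n) λ e →
         (∀ a b → e a ≡ e b → a ≡ b) × (∀ a → P (e a)) × (∀ i → P i → ∃[ a ] (e a ≡ i))
select {zero} P? = 0 , (λ ()) , (λ ()) , (λ ()) , λ ()
select {suc n} P? with P? zero | select (P? ∘ suc)
... | no ¬p | k , e , inj , sound , complete = k , suc ∘ e , (λ a b eq → inj a b (suc-injective eq)) , sound ,
  λ { zero p → ⊥-elim (¬p p) ; (suc i) q → let a , eq = complete i q in a , ≡.cong suc eq }
... | yes p | k , e , inj , sound , complete = suc k , e′ , inj′ , (λ { zero → p ; (suc a) → sound a }) ,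
  λ { zero _ → zero , ≡.refl ; (suc i) q → let a , eq = complete i q in suc a , ≡.cong suc eq }
  where
  e′ : Fin (suc k) → Fin (suc n)
  e′ zero = zero
  e′ (suc a) = suc (e a)
  inj′ : ∀ a b → e′ a ≡ e′ b → a ≡ b
  inj′ zero zero _ = ≡.refl
  inj′ (suc a) (suc b) eq = ≡.cong suc (inj a b (suc-injective eq))

module _ {c ℓ₁ ℓ₂ : Level} (F : OrderedField c ℓ₁ ℓ₂) where

  open OrderedField F hiding (zero) renaming (_<_ to infix 4 _<_; _≤_ to infix 4 _≤_)
  open IsStrictTotalOrder isStrictTotalOrder
    using (compare; <-respˡ-≈; <-respʳ-≈) renaming (_≟_ to _≈?_; _<?_ to _<?_; trans to <-trans; irrefl to <-irrefl)
  open import Algebra.Properties.Ring ring using (-0#≈0#; -‿involutive; -‿distribˡ-*; -‿distribʳ-*; -‿+-comm)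

  -- A ring solver with integer coefficients

  module RingSolver where
    open import Algebra.Properties.Semiring.Mult.TCOptimised semiring using (×-homo-+; ×1-homo-*; 1+×) renaming (_×_ to _⊠_)
    open import Algebra.Solver.Ring.AlmostCommutativeRing using (fromCommutativeRing; _-Raw-AlmostCommutative⟶_)
    open import Relation.Binary.Reasoning.Setoid setoid
    open import Data.Sign as Sign using (Sign)

    -- The optimised multiple `_⊠_` sends `+ 1` to `1#` itself rather than to a sum, so the solver's
    -- constants match goals by computation.
    ⟦_⟧ᶻ : ℤ → Carrier
    ⟦ + n ⟧ᶻ = n ⊠ 1#
    ⟦ -[1+ n ] ⟧ᶻ = - (suc n ⊠ 1#)

    cancel-1 : ∀ a b → (1# + a) + - (1# + b) ≈ a + - b
    cancel-1 a b = begin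
      (1# + a) + - (1# + b)     ≈⟨ +-congˡ (-‿+-comm 1# b) ⟨
      (1# + a) + (- 1# + - b)   ≈⟨ +-congʳ (+-comm 1# a) ⟩
      (a + 1#) + (- 1# + - b)   ≈⟨ +-assoc _ _ _ ⟩
      a + (1# + (- 1# + - b))   ≈⟨ +-congˡ (+-assoc _ _ _) ⟨
      a + ((1# + - 1#) + - b)   ≈⟨ +-congˡ (+-congʳ (-‿inverseʳ 1#)) ⟩
      a + (0# + - b)            ≈⟨ +-congˡ (+-identityˡ _) ⟩
      a + - b                   ∎

    ⊖-homo : ∀ m n → ⟦ m ℤ.⊖ n ⟧ᶻ ≈ m ⊠ 1# + - (n ⊠ 1#)
    ⊖-homo m zero = sym (trans (+-congˡ -0#≈0#) (+-identityʳ _))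
    ⊖-homo zero (suc n) = sym (+-identityˡ _)
    ⊖-homo (suc m) (suc n) = begin
      ⟦ suc m ℤ.⊖ suc n ⟧ᶻ                ≡⟨ ≡.cong ⟦_⟧ᶻ (ℤ.[1+m]⊖[1+n]≡m⊖n m n) ⟩
      ⟦ m ℤ.⊖ n ⟧ᶻ                        ≈⟨ ⊖-homo m n ⟩
      m ⊠ 1# + - (n ⊠ 1#)                 ≈⟨ cancel-1 _ _ ⟨
      (1# + m ⊠ 1#) + - (1# + n ⊠ 1#)     ≈⟨ +-cong (1+× m 1#) (-‿cong (1+× n 1#)) ⟨
      suc m ⊠ 1# + - (suc n ⊠ 1#)         ∎

    +-homo : ∀ i j → ⟦ i ℤ.+ j ⟧ᶻ ≈ ⟦ i ⟧ᶻ + ⟦ j ⟧ᶻ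
    +-homo (+ m) (+ n) = ×-homo-+ 1# m n
    +-homo (+ m) -[1+ n ] = ⊖-homo m (suc n)
    +-homo -[1+ m ] (+ n) = trans (⊖-homo n (suc m)) (+-comm _ _)
    +-homo -[1+ m ] -[1+ n ] = begin
      - (suc (suc (m ℕ.+ n)) ⊠ 1#)         ≡⟨ ≡.cong (λ k → - (k ⊠ 1#)) (≡.sym (+-suc (suc m) n)) ⟩
      - ((suc m ℕ.+ suc n) ⊠ 1#)           ≈⟨ -‿cong (×-homo-+ 1# (suc m) (suc n)) ⟩
      - (suc m ⊠ 1# + suc n ⊠ 1#)          ≈⟨ -‿+-comm _ _ ⟨
      - (suc m ⊠ 1#) + - (suc n ⊠ 1#)      ∎
      where open import Data.Nat.Properties using (+-suc)

    -◃-homo : ∀ n → ⟦ Sign.- ℤ.◃ n ⟧ᶻ ≈ - (n ⊠ 1#)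
    -◃-homo zero = sym -0#≈0#
    -◃-homo (suc n) = refl

    +◃-homo : ∀ n → ⟦ Sign.+ ℤ.◃ n ⟧ᶻ ≈ n ⊠ 1#
    +◃-homo zero = refl
    +◃-homo (suc n) = refl

    *-homo : ∀ i j → ⟦ i ℤ.* j ⟧ᶻ ≈ ⟦ i ⟧ᶻ * ⟦ j ⟧ᶻ
    *-homo (+ m) (+ n) = trans (+◃-homo (m ℕ.* n)) (×1-homo-* m n)
    *-homo (+ m) -[1+ n ] =
      trans (-◃-homo (m ℕ.* suc n)) (trans (-‿cong (×1-homo-* m (suc n))) (-‿distribʳ-* _ _))
    *-homo -[1+ m ] (+ n) =
      trans (-◃-homo (suc m ℕ.* n)) (trans (-‿cong (×1-homo-* (suc m) n)) (-‿distribˡ-* _ _))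
    *-homo -[1+ m ] -[1+ n ] = begin
      (suc m ℕ.* suc n) ⊠ 1#               ≈⟨ ×1-homo-* (suc m) (suc n) ⟩
      suc m ⊠ 1# * (suc n ⊠ 1#)            ≈⟨ -‿involutive _ ⟨
      - - (suc m ⊠ 1# * (suc n ⊠ 1#))      ≈⟨ -‿cong (-‿distribˡ-* _ _) ⟩
      - (- (suc m ⊠ 1#) * (suc n ⊠ 1#))    ≈⟨ -‿distribʳ-* _ _ ⟩
      - (suc m ⊠ 1#) * - (suc n ⊠ 1#)      ∎

    -‿homo : ∀ i → ⟦ ℤ.- i ⟧ᶻ ≈ - ⟦ i ⟧ᶻ
    -‿homo (+ zero) = sym -0#≈0#
    -‿homo (+ suc n) = refl
    -‿homo -[1+ n ] = sym (-‿involutive _)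

    morphism : ℤ.+-*-rawRing -Raw-AlmostCommutative⟶ fromCommutativeRing commRing
    morphism = record
      { ⟦_⟧ = ⟦_⟧ᶻ ; +-homo = +-homo ; *-homo = *-homo ; -‿homo = -‿homo
      ; 0-homo = refl ; 1-homo = refl }

    ≟ᶻ : ∀ i j → Maybe (⟦ i ⟧ᶻ ≈ ⟦ j ⟧ᶻ)
    ≟ᶻ i j with i ℤ.≟ j
    ... | yes i≡j = just (reflexive (≡.cong ⟦_⟧ᶻ i≡j))
    ... | no _ = nothing

    open import Algebra.Solver.Ring ℤ.+-*-rawRing (fromCommutativeRing commRing) morphism ≟ᶻ public
      using (solve; _:=_; _:+_; _:*_; :-_; con; Polynomial)

    :0 :1 : ∀ {n} → Polynomial n
    :0 = con (+ 0)
    :1 = con (+ 1)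

  open RingSolver using (solve; _:=_; _:+_; _:*_; :-_; :0; :1)

  -- Signs and inverses in an ordered field

  <-resp : ∀ {x x′ y y′} → x ≈ x′ → y ≈ y′ → x < y → x′ < y′
  <-resp p q r = <-respˡ-≈ p (<-respʳ-≈ q r)

  <-asym : ∀ {x y} → x < y → y < x → ⊥
  <-asym p q = <-irrefl refl (<-trans p q)

  pos⇒≉0 : ∀ {x} → 0# < x → ¬ (x ≈ 0#)
  pos⇒≉0 p e = <-irrefl (sym e) p

  neg⇒≉0 : ∀ {x} → x < 0# → ¬ (x ≈ 0#)
  neg⇒≉0 p e = <-irrefl e p

  neg⇒-pos : ∀ {x} → x < 0# → 0# < - x
  neg⇒-pos {x} p = <-resp (-‿inverseʳ x) (+-identityˡ _) (+-mono-< (- x) p)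

  -pos⇒neg : ∀ {x} → 0# < - x → x < 0#
  -pos⇒neg {x} p = <-resp (+-identityˡ _) (-‿inverseˡ x) (+-mono-< x p)

  pos⇒-neg : ∀ {x} → 0# < x → - x < 0#
  pos⇒-neg {x} p = -pos⇒neg (<-respʳ-≈ (sym (-‿involutive x)) p)

  <⇒0<- : ∀ {x y} → x < y → 0# < y + - x
  <⇒0<- {x} p = <-respˡ-≈ (-‿inverseʳ x) (+-mono-< (- x) p)

  0<-⇒< : ∀ {x y} → 0# < y + - x → x < y
  0<-⇒< {x} {y} p = <-resp (+-identityˡ x) (solve 2 (λ x y → (y :+ :- x) :+ x := y) refl x y) (+-mono-< x p)

  +-pos : ∀ {x y} → 0# < x → 0# < y → 0# < x + y
  +-pos {x} {y} p q = <-trans q (<-resp (+-identityˡ y) refl (+-mono-< y p))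

  *-neg-pos : ∀ {x y} → x < 0# → 0# < y → x * y < 0#
  *-neg-pos {x} {y} p q = -pos⇒neg (<-respʳ-≈ (sym (-‿distribˡ-* x y)) (*-pos (neg⇒-pos p) q))

  *-pos-neg : ∀ {x y} → 0# < x → y < 0# → x * y < 0#
  *-pos-neg p q = <-respˡ-≈ (*-comm _ _) (*-neg-pos q p)

  *-neg-neg : ∀ {x y} → x < 0# → y < 0# → 0# < x * y
  *-neg-neg {x} {y} p q =
    <-respʳ-≈ (solve 2 (λ x y → :- x :* :- y := x :* y) refl x y) (*-pos (neg⇒-pos p) (neg⇒-pos q))

  0<1 : 0# < 1#
  0<1 with compare 0# 1#
  ... | tri< p _ _ = p
  ... | tri≈ _ e _ = ⊥-elim (1≉0 (sym e))
  ... | tri> _ _ p = <-respʳ-≈ (*-identityˡ 1#) (*-neg-neg p p)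

  *-cancelʳ-0 : ∀ {x y} → ¬ (y ≈ 0#) → x * y ≈ 0# → x ≈ 0#
  *-cancelʳ-0 {x} {y} y≉0 xy≈0 with inverse y y≉0
  ... | z , yz≈1 = begin
    x            ≈⟨ *-identityʳ x ⟨
    x * 1#       ≈⟨ *-congˡ yz≈1 ⟨
    x * (y * z)  ≈⟨ *-assoc x y z ⟨
    x * y * z    ≈⟨ *-congʳ xy≈0 ⟩
    0# * z       ≈⟨ zeroˡ z ⟩
    0#           ∎
    where open import Relation.Binary.Reasoning.Setoid setoid

  abstract
    -- Total, with `0#` sent to `0#`, so that ratios such as `ρ` can be formed before it is known
    -- where the denominator vanishes.
    _⁻¹ : Carrier → Carrier
    x ⁻¹ with x ≈? 0#
    ... | yes _ = 0#
    ... | no x≉0 = proj₁ (inverse x x≉0)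

    ⁻¹-inverseˡ : ∀ {x} → ¬ (x ≈ 0#) → x ⁻¹ * x ≈ 1#
    ⁻¹-inverseˡ {x} p with x ≈? 0#
    ... | yes q = ⊥-elim (p q)
    ... | no x≉0 = trans (*-comm _ _) (proj₂ (inverse x x≉0))

  ⁻¹-pos : ∀ {x} → 0# < x → 0# < x ⁻¹
  ⁻¹-pos {x} p with compare 0# (x ⁻¹)
  ... | tri< q _ _ = q
  ... | tri≈ _ e _ = ⊥-elim (1≉0 (trans (sym (⁻¹-inverseˡ (pos⇒≉0 p))) (trans (*-congʳ (sym e)) (zeroˡ x))))
  ... | tri> _ _ q = ⊥-elim (<-asym (<-respˡ-≈ (⁻¹-inverseˡ (pos⇒≉0 p)) (*-neg-pos q p)) 0<1)

  -- As `y` is nonzero, the solutions `(u , v)` of the equation form the line through `(y , - x)`.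
  proportional : ∀ {x y u v} → 0# < y → u * x + v * y ≈ 0# → ∃[ s ] (u ≈ s * y × v ≈ s * - x)
  proportional {x} {y} {u} {v} y>0 balance = u * y ⁻¹ , u≈ , v≈
    where
    open import Relation.Binary.Reasoning.Setoid setoid
    u≈ : u ≈ u * y ⁻¹ * y
    u≈ = sym (trans (*-assoc _ _ _) (trans (*-congˡ (⁻¹-inverseˡ (pos⇒≉0 y>0))) (*-identityʳ u)))
    v≈ : v ≈ u * y ⁻¹ * - x
    v≈ = begin
      v                                  ≈⟨ *-identityʳ v ⟨
      v * 1#                             ≈⟨ *-congˡ (⁻¹-inverseˡ (pos⇒≉0 y>0)) ⟨
      v * (y ⁻¹ * y)                     ≈⟨ solve 5 (λ u v x y z → v :* (z :* y) :=
                                              z :* (u :* x :+ v :* y) :+ u :* z :* (:- x)) refl u v x y (y ⁻¹) ⟩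
      y ⁻¹ * (u * x + v * y) + u * y ⁻¹ * - x ≈⟨ +-congʳ (trans (*-congˡ balance) (zeroʳ _)) ⟩
      0# + u * y ⁻¹ * - x                ≈⟨ +-identityˡ _ ⟩
      u * y ⁻¹ * - x                     ∎

  neg-or-nonneg : ∀ x → x < 0# ⊎ 0# ≤ x
  neg-or-nonneg x with compare 0# x
  ... | tri< p _ _ = inj₂ (inj₁ p)
  ... | tri≈ _ e _ = inj₂ (inj₂ e)
  ... | tri> _ _ p = inj₁ p

  ≤-respʳ : ∀ {x y z} → y ≈ z → x ≤ y → x ≤ z
  ≤-respʳ e (inj₁ p) = inj₁ (<-respʳ-≈ e p)
  ≤-respʳ e (inj₂ p) = inj₂ (trans p e)

  +-nonneg : ∀ {x y} → 0# ≤ x → 0# ≤ y → 0# ≤ x + y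
  +-nonneg (inj₁ p) (inj₁ q) = inj₁ (+-pos p q)
  +-nonneg {x} (inj₁ p) (inj₂ q) = inj₁ (<-respʳ-≈ (trans (sym (+-identityʳ x)) (+-congˡ q)) p)
  +-nonneg {x} {y} (inj₂ p) q = ≤-respʳ (trans (sym (+-identityˡ y)) (+-congʳ p)) q

  +-pos-nonneg : ∀ {x y} → 0# < x → 0# ≤ y → 0# < x + y
  +-pos-nonneg p (inj₁ q) = +-pos p q
  +-pos-nonneg {x} p (inj₂ q) = <-respʳ-≈ (trans (sym (+-identityʳ x)) (+-congˡ q)) p

  *-nonneg : ∀ {x y} → 0# ≤ x → 0# ≤ y → 0# ≤ x * y
  *-nonneg (inj₁ p) (inj₁ q) = inj₁ (*-pos p q)
  *-nonneg {x} (inj₁ p) (inj₂ q) = inj₂ (trans (sym (zeroʳ x)) (*-congˡ q))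
  *-nonneg {x} {y} (inj₂ p) _ = inj₂ (trans (sym (zeroˡ y)) (*-congʳ p))

  nonneg⇒≮0 : ∀ {x} → 0# ≤ x → ¬ (x < 0#)
  nonneg⇒≮0 (inj₁ p) q = <-asym p q
  nonneg⇒≮0 (inj₂ p) q = <-irrefl (sym p) q

  ≤⇒0≤- : ∀ {x y} → x ≤ y → 0# ≤ y + - x
  ≤⇒0≤- (inj₁ p) = inj₁ (<⇒0<- p)
  ≤⇒0≤- {x} (inj₂ p) = inj₂ (trans (sym (-‿inverseʳ x)) (+-congʳ p))

  -- Finite sums

  Σ[_] : ∀ {m} → (Fin m → Carrier) → Carrier
  Σ[_] = Σs F

  Σ-cong : ∀ {m} {f g : Fin m → Carrier} → (∀ i → f i ≈ g i) → Σ[ f ] ≈ Σ[ g ]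
  Σ-cong {zero} e = refl
  Σ-cong {suc m} e = +-cong (e zero) (Σ-cong (λ i → e (suc i)))

  Σ-zero : ∀ {m} {f : Fin m → Carrier} → (∀ i → f i ≈ 0#) → Σ[ f ] ≈ 0#
  Σ-zero {zero} e = refl
  Σ-zero {suc m} e = trans (+-cong (e zero) (Σ-zero (λ i → e (suc i)))) (+-identityˡ 0#)

  Σ-+ : ∀ {m} (f g : Fin m → Carrier) → Σ[ (λ i → f i + g i) ] ≈ Σ[ f ] + Σ[ g ]
  Σ-+ {zero} f g = sym (+-identityˡ 0#)
  Σ-+ {suc m} f g = trans (+-congˡ (Σ-+ (λ i → f (suc i)) (λ i → g (suc i))))
    (solve 4 (λ a b x y → (a :+ b) :+ (x :+ y) := (a :+ x) :+ (b :+ y)) refl _ _ _ _)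

  Σ-*ˡ : ∀ {m} a (f : Fin m → Carrier) → Σ[ (λ i → a * f i) ] ≈ a * Σ[ f ]
  Σ-*ˡ {zero} a f = sym (zeroʳ a)
  Σ-*ˡ {suc m} a f = trans (+-congˡ (Σ-*ˡ a (λ i → f (suc i)))) (sym (distribˡ a _ _))

  Σ-*ʳ : ∀ {m} (f : Fin m → Carrier) a → Σ[ (λ i → f i * a) ] ≈ Σ[ f ] * a
  Σ-*ʳ {m} f a = trans (Σ-cong {m} (λ i → *-comm (f i) a)) (trans (Σ-*ˡ a f) (*-comm _ _))

  Σ-swap : ∀ {m k} (f : Fin m → Fin k → Carrier) →
           Σ[ (λ i → Σ[ f i ]) ] ≈ Σ[ (λ j → Σ[ (λ i → f i j) ]) ]
  Σ-swap {zero} {k} f = sym (Σ-zero {k} (λ j → refl))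
  Σ-swap {suc m} {k} f = trans (+-congˡ (Σ-swap (λ i → f (suc i)))) (sym (Σ-+ (f zero) _))

  Σ-single : ∀ {m} {f : Fin m → Carrier} a → (∀ i → i ≢ a → f i ≈ 0#) → Σ[ f ] ≈ f a
  Σ-single zero e = trans (+-congˡ (Σ-zero (λ i → e (suc i) (λ ())))) (+-identityʳ _)
  Σ-single (suc a) e =
    trans (+-cong (e zero (λ ())) (Σ-single a (λ i p → e (suc i) (λ q → p (suc-injective q))))) (+-identityˡ _)

  Σ-nonneg : ∀ {m} {f : Fin m → Carrier} → (∀ i → 0# ≤ f i) → 0# ≤ Σ[ f ]
  Σ-nonneg {zero} e = inj₂ refl
  Σ-nonneg {suc m} e = +-nonneg (e zero) (Σ-nonneg (λ i → e (suc i)))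

  Σ-pos : ∀ {m} {f : Fin m → Carrier} → (∀ i → 0# ≤ f i) → ∀ a → 0# < f a → 0# < Σ[ f ]
  Σ-pos e zero p = +-pos-nonneg p (Σ-nonneg (λ i → e (suc i)))
  Σ-pos e (suc a) p = <-respʳ-≈ (+-comm _ _) (+-pos-nonneg (Σ-pos (λ i → e (suc i)) a p) (e zero))

  abstract
    δ : ∀ {m} → Fin m → Fin m → Carrier
    δ i j with i ≟ j
    ... | yes _ = 1#
    ... | no _ = 0#

    δ-refl : ∀ {m} (i : Fin m) → δ i i ≈ 1#
    δ-refl i with i ≟ i
    ... | yes _ = refl
    ... | no p = ⊥-elim (p ≡.refl)

    δ-≢ : ∀ {m} {i j : Fin m} → i ≢ j → δ i j ≈ 0#
    δ-≢ {i = i} {j} p with i ≟ j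
    ... | yes q = ⊥-elim (p q)
    ... | no _ = refl

    δ-nonneg : ∀ {m} (i j : Fin m) → 0# ≤ δ i j
    δ-nonneg i j with i ≟ j
    ... | yes _ = inj₁ 0<1
    ... | no _ = inj₂ refl

    δ-suc : ∀ {m} (i j : Fin m) → δ (suc i) (suc j) ≈ δ i j
    δ-suc i j with i ≟ j
    ... | yes _ = refl
    ... | no _ = refl

  δ-≡ : ∀ {m} {i j : Fin m} → i ≡ j → δ i j ≈ 1#
  δ-≡ {i = i} ≡.refl = δ-refl i

  Σ-δʳ : ∀ {m} (f : Fin m → Carrier) j → Σ[ (λ i → f i * δ i j) ] ≈ f j
  Σ-δʳ f j = trans (Σ-single j (λ i p → trans (*-congˡ (δ-≢ p)) (zeroʳ _)))
    (trans (*-congˡ (δ-refl j)) (*-identityʳ _))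

  Σ-δˡ : ∀ {m} i (f : Fin m → Carrier) → Σ[ (λ j → δ i j * f j) ] ≈ f i
  Σ-δˡ i f = trans (Σ-single i (λ j p → trans (*-congʳ (δ-≢ (λ q → p (≡.sym q)))) (zeroˡ _)))
    (trans (*-congʳ (δ-refl i)) (*-identityˡ _))

  argmax : ∀ {m p} {P : Fin m → Set p} → Decidable P → (f : Fin m → Carrier) →
           (∀ i → ¬ P i) ⊎ ∃[ a ] (P a × (∀ i → P i → f i ≤ f a))
  argmax {zero} P? f = inj₁ λ ()
  argmax {suc m} P? f with P? zero | argmax (λ i → P? (suc i)) (λ i → f (suc i))
  ... | no ¬p | inj₁ none = inj₁ λ { zero → ¬p ; (suc i) → none i }
  ... | no ¬p | inj₂ (a , pa , max) = inj₂ (suc a , pa , λ { zero q → ⊥-elim (¬p q) ; (suc i) → max i })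
  ... | yes p | inj₁ none = inj₂ (zero , p , λ { zero _ → inj₂ refl ; (suc i) q → ⊥-elim (none i q) })
  ... | yes p | inj₂ (a , pa , max) with compare (f zero) (f (suc a))
  ... | tri< q _ _ = inj₂ (suc a , pa , λ { zero _ → inj₁ q ; (suc i) → max i })
  ... | tri≈ _ q _ = inj₂ (suc a , pa , λ { zero _ → inj₂ q ; (suc i) → max i })
  ... | tri> _ _ q = inj₂ (zero , p , λ { zero _ → inj₂ refl ; (suc i) r → inj₁ (below (max i r)) })
    where
    below : ∀ {x} → x ≤ f (suc a) → x < f zero
    below (inj₁ r) = <-trans r q
    below (inj₂ r) = <-respˡ-≈ (sym r) q

  -- Dependencies, circuits and skeletons

  Coeffs : ℕ → Set c
  Coeffs m = Fin m → Carrier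

  -- Stands for the space of dependencies of a vector family. The extension step sees nothing else
  -- of the vectors.
  record Subspace {m} (D : Coeffs m → Set ℓ₁) : Set (c ⊔ ℓ₁) where
    field
      resp : ∀ {β γ} → (∀ i → β i ≈ γ i) → D β → D γ
      null : D (λ _ → 0#)
      _⊕_·_ : ∀ {β γ} → D β → ∀ a → D γ → D (λ i → β i + a * γ i)

    scale : ∀ {β} a → D β → D (λ i → a * β i)
    scale a d = resp (λ i → +-identityˡ _) (null ⊕ a · d)

    sum : ∀ {k} (a : Fin k → Carrier) (f : Fin k → Coeffs m) → (∀ i → D (f i)) →
          D (λ j → Σ[ (λ i → a i * f i j) ])
    sum {zero} a f d = null
    sum {suc k} a f d =
      resp (λ j → trans (+-congˡ (*-identityˡ _)) refl)
        (scale (a zero) (d zero) ⊕ 1# · sum (λ i → a (suc i)) (λ i → f (suc i)) (λ i → d (suc i)))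

  Supp : ∀ {m} → Coeffs m → Coeffs m → Set ℓ₁
  Supp β α = ∀ i → α i ≈ 0# → β i ≈ 0#

  -- Minimality of the support in linear form: the dependencies inside the support are one line. The
  -- zero vector qualifies as well, but `BadSigns` excludes it.
  Circuit : ∀ {m} → (Coeffs m → Set ℓ₁) → Coeffs m → Set (c ⊔ ℓ₁)
  Circuit D α = D α × (∀ β → Supp β α → D β → ∃[ s ] (∀ i → β i ≈ s * α i))

  BadSigns : ∀ {m} → Coeffs m → Set ℓ₂
  BadSigns α = (∃[ p ] ∃[ q ] (p ≢ q × 0# < α p × 0# < α q))
             × (∃[ p ] ∃[ q ] (p ≢ q × α p < 0# × α q < 0#))

  NoBadCircuit : ∀ {m} → (Coeffs m → Set ℓ₁) → Set (c ⊔ ℓ₁ ⊔ ℓ₂)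
  NoBadCircuit D = ∀ α → Circuit D α → BadSigns α → ⊥

  -- Dependencies modulo the first point. `nonloop` says that this point is not zero, which makes
  -- the coefficient supplied by `lift` unique.
  record Contraction {m} (D : Coeffs (suc m) → Set ℓ₁) (D′ : Coeffs m → Set ℓ₁) : Set (c ⊔ ℓ₁) where
    field
      lift : ∀ {β} → D′ β → ∃[ a ] D (a ∷ β)
      drop : ∀ {β} → D β → D′ (λ j → β (suc j))
      nonloop : ∀ {β} → D β → (∀ j → β (suc j) ≈ 0#) → β zero ≈ 0#

  -- A skeleton recorded by coefficients: the points with w i > 0 are its vertices, lab names their
  -- blocks (a label may name no block), and w restricted to a block is its positive dependency.
  -- closed and rigid say that the dependencies among the vertices are exactly the blockwise
  -- multiples of w, which is both affine independence and independence of the spans.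
  record Skeletal {m} (D : Coeffs m → Set ℓ₁) : Set (c ⊔ ℓ₁ ⊔ ℓ₂) where
    field
      w : Coeffs m
      w≥0 : ∀ i → 0# ≤ w i
      lab : Fin m → Fin m
      closed : ∀ (t : Coeffs m) → D (λ i → t (lab i) * w i)
      rigid : ∀ β → Supp β w → D β → Σ (Coeffs m) λ t → ∀ i → β i ≈ t (lab i) * w i
      span : ∀ i → Σ (Coeffs m) λ β → Supp β w × D (λ j → β j + - δ i j)
      partner : ∀ i → 0# < w i → ∃[ j ] (j ≢ i × lab j ≡ lab i × 0# < w j)

  -- Extending a skeleton over the contracted point

  module Extend {m} {D : Coeffs (suc m) → Set ℓ₁} {D′ : Coeffs m → Set ℓ₁}
    (subspace : Subspace D) (contraction : Contraction D D′) (noBad : NoBadCircuit D)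
    (skeletal : Skeletal D′) where

    open Subspace subspace
    open Contraction contraction
    open Skeletal skeletal

    -- Block a sums to - l a times the contracted point.
    abstract
      l : Coeffs m
      l a = proj₁ (lift (closed (δ a)))

      Dl : ∀ a → D (l a ∷ (λ j → δ a (lab j) * w j))
      Dl a = proj₂ (lift (closed (δ a)))

    head-unique : ∀ {β γ} → D β → D γ → (∀ j → β (suc j) ≈ γ (suc j)) → β zero ≈ γ zero
    head-unique {β} {γ} dβ dγ e = trans
      (solve 2 (λ x y → x := (x :+ (:- :1) :* y) :+ y) refl (β zero) (γ zero))
      (trans (+-congʳ (nonloop (dβ ⊕ - 1# · dγ) λ j → trans (+-congʳ (e j))
        (solve 1 (λ x → x :+ (:- :1) :* x := :0) refl (γ (suc j))))) (+-identityˡ _))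

    Dl-comb : ∀ (t : Coeffs m) → D (Σ[ (λ a → t a * l a) ] ∷ (λ j → t (lab j) * w j))
    Dl-comb t = resp
      (λ { zero → refl
         ; (suc j) → trans (Σ-cong (λ a → sym (*-assoc (t a) (δ a (lab j)) (w j))))
             (trans (Σ-*ʳ (λ a → t a * δ a (lab j)) (w j)) (*-congʳ (Σ-δʳ t (lab j)))) })
      (sum t _ Dl)

    rigid′ : ∀ {β} → D β → Supp (λ j → β (suc j)) w →
             Σ (Coeffs m) λ t → (∀ j → β (suc j) ≈ t (lab j) * w j) × β zero ≈ Σ[ (λ a → t a * l a) ]
    rigid′ dβ supp with rigid _ supp (drop dβ)
    ... | t , e = t , e , head-unique dβ (Dl-comb t) e

    Block : Fin m → Fin m → Set ℓ₂
    Block a j = lab j ≡ a × 0# < w j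

    block? : ∀ a j → Dec (Block a j)
    block? a j = lab j ≟ a ×-dec (0# <? w j)

    w-split : ∀ j → w j ≈ 0# ⊎ 0# < w j
    w-split j with w≥0 j
    ... | inj₁ p = inj₂ p
    ... | inj₂ p = inj₁ (sym p)

    block-inhabited : ∀ {a} → ¬ (l a ≈ 0#) → ∃[ j ] Block a j
    block-inhabited {a} la≉0 with any? (block? a)
    ... | yes p = p
    ... | no none = contradiction (nonloop (Dl a) vanish) la≉0
      where
      vanish : ∀ j → δ a (lab j) * w j ≈ 0#
      vanish j with w-split j
      ... | inj₁ e = trans (*-congˡ e) (zeroʳ _)
      ... | inj₂ p = trans (*-congʳ (δ-≢ (λ e → none (j , ≡.sym e , p)))) (zeroˡ _)

    Redundant : Set (c ⊔ ℓ₁ ⊔ ℓ₂)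
    Redundant = Σ (Coeffs m) λ ν → (∀ j → 0# ≤ ν j) × D (- 1# ∷ ν)

    -- Dividing the lifted block dependency by `- l a` expresses the contracted point by nonnegative
    -- coefficients.
    redundant : ∀ a → l a < 0# → Redundant
    redundant a la<0 = _ , (λ j → *-nonneg (inj₁ (⁻¹-pos 0<-la)) (*-nonneg (δ-nonneg a (lab j)) (w≥0 j))) ,
      resp (λ { zero → head ; (suc j) → refl }) (scale ((- l a) ⁻¹) (Dl a))
      where
      0<-la = neg⇒-pos la<0
      head : (- l a) ⁻¹ * l a ≈ - 1#
      head = trans (solve 2 (λ x y → x :* y := :- (x :* (:- y))) refl ((- l a) ⁻¹) (l a))
        (-‿cong (⁻¹-inverseˡ (pos⇒≉0 0<-la)))

    -- Cancel the contracted point between the two block relations. A relation inside the resulting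
    -- support is given by two block factors, and the zero coefficient of the contracted point ties
    -- them together, so this is a circuit. By `partner` each block has two points, hence two
    -- coefficients of each sign.
    ¬two-positive : ∀ {a b} → a ≢ b → 0# < l a → 0# < l b → ⊥
    ¬two-positive {a} {b} a≢b la>0 lb>0 = noBad α (Dα , circuit) (positives , negatives)
      where
      τ : Carrier → Carrier → Fin m → Carrier
      τ x y e = x * δ a e + y * δ b e

      Dτ : ∀ x y → D ((x * l a + y * l b) ∷ (λ j → τ x y (lab j) * w j))
      Dτ x y = resp
        (λ { zero → refl
           ; (suc j) → solve 5 (λ x y p q w → x :* (p :* w) :+ y :* (q :* w) := (x :* p :+ y :* q) :* w) refl
               x y (δ a (lab j)) (δ b (lab j)) (w j) })
        (scale x (Dl a) ⊕ y · Dl b)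

      α : Coeffs (suc m)
      α = 0# ∷ (λ j → τ (l b) (- l a) (lab j) * w j)

      Dα : D α
      Dα = resp
        (λ { zero → solve 2 (λ x y → x :* y :+ (:- y) :* x := :0) refl (l b) (l a)
           ; (suc j) → refl })
        (Dτ (l b) (- l a))

      at-a : ∀ x y {e} → e ≡ a → τ x y e ≈ x
      at-a x y ≡.refl = trans (+-cong (*-congˡ (δ-refl _)) (*-congˡ (δ-≢ λ e → a≢b (≡.sym e))))
        (solve 2 (λ x y → x :* :1 :+ y :* :0 := x) refl x y)

      at-b : ∀ x y {e} → e ≡ b → τ x y e ≈ y
      at-b x y ≡.refl = trans (+-cong (*-congˡ (δ-≢ a≢b)) (*-congˡ (δ-refl _)))
        (solve 2 (λ x y → x :* :0 :+ y :* :1 := y) refl x y)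

      elsewhere : ∀ x y {e} → e ≢ a → e ≢ b → τ x y e ≈ 0#
      elsewhere x y p q = trans (+-cong (*-congˡ (δ-≢ λ e → p (≡.sym e))) (*-congˡ (δ-≢ λ e → q (≡.sym e))))
        (solve 2 (λ x y → x :* :0 :+ y :* :0 := :0) refl x y)

      masked : ∀ {β} t → Supp β α → (∀ j → β (suc j) ≈ t (lab j) * w j) →
               ∀ j → β (suc j) ≈ τ (t a) (t b) (lab j) * w j
      masked t supp β≈ j with lab j ≟ a | lab j ≟ b
      ... | yes p | _ = trans (β≈ j) (*-congʳ (trans (reflexive (≡.cong t p)) (sym (at-a _ _ p))))
      ... | no _ | yes p = trans (β≈ j) (*-congʳ (trans (reflexive (≡.cong t p)) (sym (at-b _ _ p))))
      ... | no p | no q = trans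
        (supp (suc j) (trans (*-congʳ (elsewhere _ _ p q)) (zeroˡ _)))
        (sym (trans (*-congʳ (elsewhere _ _ p q)) (zeroˡ _)))

      τ-scale : ∀ {x y} s {x′ y′} → x ≈ s * x′ → y ≈ s * y′ → ∀ e → τ x y e ≈ s * τ x′ y′ e
      τ-scale s {x′} {y′} p q e = trans (+-cong (*-congʳ p) (*-congʳ q))
        (solve 5 (λ s x y p q → (s :* x) :* p :+ (s :* y) :* q := s :* (x :* p :+ y :* q)) refl
          s x′ y′ (δ a e) (δ b e))

      circuit : ∀ β → Supp β α → D β → ∃[ s ] (∀ i → β i ≈ s * α i)
      circuit β supp dβ = multiple (rigid′ dβ (λ j e → supp (suc j) (trans (*-congˡ e) (zeroʳ _))))
        where
        multiple : (Σ (Coeffs m) λ t → (∀ j → β (suc j) ≈ t (lab j) * w j) × β zero ≈ Σ[ (λ a → t a * l a) ]) →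
                   ∃[ s ] (∀ i → β i ≈ s * α i)
        multiple (t , β≈ , _) = s , λ { zero → trans (supp zero refl) (sym (zeroʳ s)) ; (suc j) → β≈sα j }
          where
          balance : t a * l a + t b * l b ≈ 0#
          balance = trans (sym (head-unique dβ (Dτ (t a) (t b)) (masked t supp β≈))) (supp zero refl)

          factor : ∃[ s ] (t a ≈ s * l b × t b ≈ s * - l a)
          factor = proportional lb>0 balance

          s : Carrier
          s = proj₁ factor

          β≈sα : ∀ j → β (suc j) ≈ s * (τ (l b) (- l a) (lab j) * w j)
          β≈sα j = trans (masked t supp β≈ j) (trans
            (*-congʳ (τ-scale s (proj₁ (proj₂ factor)) (proj₂ (proj₂ factor)) (lab j))) (*-assoc s _ (w j)))

      α-a : ∀ {j} → Block a j → 0# < α (suc j)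
      α-a (p , wj>0) = <-respʳ-≈ (*-congʳ (sym (at-a _ _ p))) (*-pos lb>0 wj>0)

      α-b : ∀ {j} → Block b j → α (suc j) < 0#
      α-b (p , wj>0) = <-respˡ-≈ (*-congʳ (sym (at-b _ _ p))) (*-neg-pos (pos⇒-neg la>0) wj>0)

      positives : ∃[ p ] ∃[ q ] (p ≢ q × 0# < α p × 0# < α q)
      positives with block-inhabited (pos⇒≉0 la>0)
      ... | j , labj , wj>0 with partner j wj>0
      ... | k , k≢j , labk , wk>0 = suc k , suc j , (λ e → k≢j (suc-injective e)) ,
        α-a (≡.trans labk labj , wk>0) , α-a (labj , wj>0)

      negatives : ∃[ p ] ∃[ q ] (p ≢ q × α p < 0# × α q < 0#)
      negatives with block-inhabited (pos⇒≉0 lb>0)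
      ... | j , labj , wj>0 with partner j wj>0
      ... | k , k≢j , labk , wk>0 = suc k , suc j , (λ e → k≢j (suc-injective e)) ,
        α-b (≡.trans labk labj , wk>0) , α-b (labj , wj>0)

    -- By `others`, the coefficient of the contracted point in any relation on the vertices is `l a`
    -- times the factor of block `a`; so the point enters that block with weight `l a`.
    join-block : ∀ a → 0# < l a → (∀ b → b ≢ a → l b ≈ 0#) → Skeletal D
    join-block a la>0 others = record
      { w = l a ∷ w
      ; w≥0 = λ { zero → inj₁ la>0 ; (suc j) → w≥0 j }
      ; lab = suc a ∷ (λ j → suc (lab j))
      ; closed = λ t → resp
          (λ { zero → Σtl (λ b → t (suc b)) ; (suc j) → refl })
          (Dl-comb (λ b → t (suc b)))
      ; rigid = rigid-D
      ; span = span-D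
      ; partner = partner-D
      }
      where
      Σtl : ∀ t → Σ[ (λ b → t b * l b) ] ≈ t a * l a
      Σtl t = Σ-single a (λ b b≢a → trans (*-congˡ (others b b≢a)) (zeroʳ _))

      rigid-D : ∀ β → Supp β (l a ∷ w) → D β →
                Σ (Coeffs (suc m)) λ t → ∀ i → β i ≈ t ((suc a ∷ (λ j → suc (lab j))) i) * (l a ∷ w) i
      rigid-D β supp dβ with rigid′ dβ (λ j → supp (suc j))
      -- No point carries the label `zero`, so its factor is arbitrary.
      ... | t , e , e₀ = 0# ∷ t , λ { zero → trans e₀ (Σtl t) ; (suc j) → e j }

      span-D : ∀ i → Σ (Coeffs (suc m)) λ β → Supp β (l a ∷ w) × D (λ j → β j + - δ i j)
      span-D zero = δ zero ,
        (λ { zero e → contradiction e (pos⇒≉0 la>0) ; (suc j) _ → δ-≢ {i = zero} {suc j} λ () }) ,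
        resp (λ i → sym (-‿inverseʳ _)) null
      span-D (suc i) with span i
      ... | β , supp , d with lift d
      ... | a₀ , d₀ = a₀ ∷ β ,
        (λ { zero e → contradiction e (pos⇒≉0 la>0) ; (suc j) → supp j }) ,
        resp (λ { zero → trans (solve 1 (λ x → x := x :+ :- :0) refl a₀)
                           (+-congˡ (-‿cong (sym (δ-≢ {i = suc i} {zero} λ ()))))
                ; (suc j) → +-congˡ (-‿cong (sym (δ-suc i j))) }) d₀

      partner-D : ∀ i → 0# < (l a ∷ w) i → ∃[ j ] (j ≢ i ×
        (suc a ∷ (λ j → suc (lab j))) j ≡ (suc a ∷ (λ j → suc (lab j))) i × 0# < (l a ∷ w) j)
      partner-D zero _ with block-inhabited (pos⇒≉0 la>0)
      ... | j , labj , wj>0 = suc j , (λ ()) , ≡.cong suc labj , wj>0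
      partner-D (suc i) wi>0 with partner i wi>0
      ... | j , j≢i , e , wj>0 = suc j , (λ p → j≢i (suc-injective p)) , ≡.cong suc e , wj>0

  -- All block sums zero: forming a new block

  module Merge {m} {D : Coeffs (suc m) → Set ℓ₁} {D′ : Coeffs m → Set ℓ₁}
    (subspace : Subspace D) (contraction : Contraction D D′) (noBad : NoBadCircuit D)
    (skeletal : Skeletal D′)
    (l≈0 : ∀ a → Extend.l subspace contraction noBad skeletal a ≈ 0#) where

    open Subspace subspace
    open Contraction contraction
    open Skeletal skeletal
    open Extend subspace contraction noBad skeletal

    closed₀ : ∀ (t : Coeffs m) → D (0# ∷ (λ j → t (lab j) * w j))
    closed₀ t = resp (λ { zero → Σ-zero (λ a → trans (*-congˡ (l≈0 a)) (zeroʳ (t a))) ; (suc j) → refl })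
      (Dl-comb t)

    -- Block relations no longer involve the contracted point, so that point lies outside the span
    -- of the vertices.
    rigid₀ : ∀ {β} → D β → Supp (λ j → β (suc j)) w →
             (Σ (Coeffs m) λ t → ∀ j → β (suc j) ≈ t (lab j) * w j) × β zero ≈ 0#
    rigid₀ {β} dβ supp = (proj₁ r , proj₁ (proj₂ r)) ,
      trans (proj₂ (proj₂ r)) (Σ-zero (λ a → trans (*-congˡ (l≈0 a)) (zeroʳ (proj₁ r a))))
      where
      r : Σ (Coeffs m) λ t → (∀ j → β (suc j) ≈ t (lab j) * w j) × β zero ≈ Σ[ (λ a → t a * l a) ]
      r = rigid′ dβ supp

    -- The coordinate of a point along the contracted point, modulo the span of the vertices.
    height : Fin m → Carrier
    height i = proj₁ (lift (proj₂ (proj₂ (span i))))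

    base : Fin m → Coeffs m
    base i = proj₁ (span i)

    base-supp : ∀ i → Supp (base i) w
    base-supp i = proj₁ (proj₂ (span i))

    D-height : ∀ i → D (height i ∷ (λ j → base i j + - δ i j))
    D-height i = proj₂ (lift (proj₂ (proj₂ (span i))))

    -- Replacing every point in `μ` by its expression leaves a relation on the vertices and the
    -- contracted point. There the latter has coefficient `μ zero` plus a positively weighted sum of
    -- heights, and `rigid₀` forces this to be zero.
    below-hyperplane : ∀ {μ : Coeffs (suc m)} → (∀ i → 0# < μ i) → D μ → ∃[ y ] (height y < 0#)
    below-hyperplane {μ} μ>0 Dμ with any? (λ i → height i <? 0#)
    ... | yes p = p
    ... | no none = contradiction (proj₂ (rigid₀ combination supp)) (pos⇒≉0 positive)
      where
      height≥0 : ∀ i → 0# ≤ height i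
      height≥0 i with neg-or-nonneg (height i)
      ... | inj₁ p = ⊥-elim (none (i , p))
      ... | inj₂ p = p

      total : Coeffs (suc m)
      total i = μ i + 1# * Σ[ (λ k → μ (suc k) * (height k ∷ (λ j → base k j + - δ k j)) i) ]

      combination : D total
      combination = Dμ ⊕ 1# · sum (λ k → μ (suc k)) _ D-height

      positive : 0# < total zero
      positive = +-pos-nonneg (μ>0 zero) (*-nonneg (inj₁ 0<1)
        (Σ-nonneg (λ k → *-nonneg (inj₁ (μ>0 (suc k))) (height≥0 k))))

      supp : Supp (λ j → total (suc j)) w
      supp j wj≈0 = begin
        μ (suc j) + 1# * Σ[ (λ k → μ (suc k) * (base k j + - δ k j)) ]
          ≈⟨ +-congˡ (*-congˡ (Σ-cong (λ k → trans
               (*-congˡ (+-congʳ (base-supp k j wj≈0)))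
               (solve 2 (λ x y → x :* (:0 :+ :- y) := (:- :1) :* (x :* y)) refl (μ (suc k)) (δ k j))))) ⟩
        μ (suc j) + 1# * Σ[ (λ k → - 1# * (μ (suc k) * δ k j)) ]
          ≈⟨ +-congˡ (*-congˡ (trans (Σ-*ˡ (- 1#) (λ k → μ (suc k) * δ k j)) (*-congˡ (Σ-δʳ (λ k → μ (suc k)) j)))) ⟩
        μ (suc j) + 1# * (- 1# * μ (suc j))
          ≈⟨ solve 1 (λ x → x :+ :1 :* ((:- :1) :* x) := :0) refl (μ (suc j)) ⟩
        0# ∎
        where open import Relation.Binary.Reasoning.Setoid setoid

    module _ (y : Fin m) (height<0 : height y < 0#) where

      s : Carrier
      s = height y

      -s>0 : 0# < - s
      -s>0 = neg⇒-pos height<0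

      -- A vertex of the skeleton has height zero by `rigid₀`, so `y` is not a vertex.
      wy≈0 : w y ≈ 0#
      wy≈0 with w y ≈? 0#
      ... | yes p = p
      ... | no wy≉0 = contradiction (proj₂ (rigid₀ (D-height y) supp)) (neg⇒≉0 height<0)
        where
        supp : Supp (λ j → base y j + - δ y j) w
        supp j wj≈0 = trans (+-cong (base-supp y j wj≈0)
          (-‿cong (δ-≢ (λ { ≡.refl → wy≉0 wj≈0 })))) (-‿inverseʳ 0#)

      pos⇒≢y : ∀ {j} → 0# < w j → y ≢ j
      pos⇒≢y p ≡.refl = pos⇒≉0 p wy≈0

      -- Adding a multiple of a block dependency shifts all ratios to `w` on that block by one
      -- constant; signs of coefficients thus become comparisons between `ρ` and the shift.
      ρ : Coeffs m
      ρ j = base y j * w j ⁻¹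

      base≈ρw : ∀ j → base y j ≈ ρ j * w j
      base≈ρw j with w-split j
      ... | inj₁ e = trans (base-supp y j e) (sym (trans (*-congˡ e) (zeroʳ _)))
      ... | inj₂ p = sym (trans (*-assoc _ _ _)
        (trans (*-congˡ (⁻¹-inverseˡ (pos⇒≉0 p))) (*-identityʳ _)))

      -- The relation expressing `y`, negated and shifted by `M` on each block. As `M` varies,
      -- `reduce` shows that these are all the relations among the contracted point, `y` and the
      -- vertices in which `y` has coefficient one.
      α : Coeffs m → Coeffs (suc m)
      α M = - s ∷ (λ j → δ y j + (M (lab j) + - ρ j) * w j)

      Dα : ∀ M → D (α M)
      Dα M = resp
        (λ { zero → solve 1 (λ x → :0 :+ (:- :1) :* x := :- x) refl s
           ; (suc j) → trans (+-congˡ (*-congˡ (+-congʳ (base≈ρw j))))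
               (solve 4 (λ M ρ w d → M :* w :+ (:- :1) :* (ρ :* w :+ :- d) := d :+ (M :+ :- ρ) :* w) refl
                 (M (lab j)) (ρ j) (w j) (δ y j)) })
        (closed₀ M ⊕ - 1# · D-height y)

      α-y : ∀ M → α M (suc y) ≈ 1#
      α-y M = trans (+-cong (δ-refl y) (trans (*-congˡ wy≈0) (zeroʳ _))) (+-identityʳ 1#)

      α-≢y : ∀ M {j} → y ≢ j → α M (suc j) ≈ (M (lab j) + - ρ j) * w j
      α-≢y M p = trans (+-congʳ (δ-≢ p)) (+-identityˡ _)

      α-unsupported : ∀ M {j} → y ≢ j → w j ≈ 0# → α M (suc j) ≈ 0#
      α-unsupported M p e = trans (α-≢y M p) (trans (*-congˡ e) (zeroʳ _))

      α-tight : ∀ M {p} → 0# < w p → ρ p ≈ M (lab p) → α M (suc p) ≈ 0#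
      α-tight M {p} wp>0 e = trans (α-≢y M (pos⇒≢y wp>0))
        (trans (*-congʳ (trans (+-congˡ (-‿cong e)) (-‿inverseʳ _))) (zeroˡ _))

      reduce : ∀ M {β} → D β → (∀ j → w j ≈ 0# → y ≢ j → β (suc j) ≈ 0#) →
               (Σ (Coeffs m) λ t → ∀ j → β (suc j) ≈ β (suc y) * α M (suc j) + t (lab j) * w j)
               × β zero ≈ β (suc y) * - s
      reduce M {β} dβ supp = (t , λ j → move (proj₂ (proj₁ r) j)) , trans (move (proj₂ r)) (+-identityʳ _)
        where
        b : Carrier
        b = β (suc y)

        supp′ : Supp (λ j → β (suc j) + - b * α M (suc j)) w
        supp′ j e with y ≟ j
        ... | yes ≡.refl = trans (+-congˡ (*-congˡ (α-y M)))
          (solve 1 (λ b → b :+ (:- b) :* :1 := :0) refl b)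
        ... | no p = trans (+-cong (supp j e p) (*-congˡ (α-unsupported M p e)))
          (solve 1 (λ b → :0 :+ (:- b) :* :0 := :0) refl b)

        r : (Σ (Coeffs m) λ t → ∀ j → β (suc j) + - b * α M (suc j) ≈ t (lab j) * w j)
            × β zero + - b * - s ≈ 0#
        r = rigid₀ (dβ ⊕ - b · Dα M) supp′

        t : Coeffs m
        t = proj₁ (proj₁ r)

        move : ∀ {x z u} → x + - b * z ≈ u → x ≈ b * z + u
        move {x} {z} e = trans (solve 3 (λ x b z → x := b :* z :+ (x :+ (:- b) :* z)) refl x b z) (+-congˡ e)

      -- After a multiple of `α M` is subtracted, only block multiples remain. On each block there
      -- is a vertex where both `α M` and the given relation vanish, and this forces the block's
      -- factor to be zero.
      circuit : ∀ M → (∀ j → 0# < w j → ∃[ p ] (Block (lab j) p × ρ p ≈ M (lab j))) → Circuit D (α M)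
      circuit M attained = Dα M , multiple
        where
        multiple : ∀ β → Supp β (α M) → D β → ∃[ b ] (∀ i → β i ≈ b * α M i)
        multiple β supp dβ = β (suc y) , λ { zero → proj₂ r ; (suc j) → trans (t-spec j) (trans (+-congˡ (tw≈0 j)) (+-identityʳ _)) }
          where
          r : (Σ (Coeffs m) λ t → ∀ j → β (suc j) ≈ β (suc y) * α M (suc j) + t (lab j) * w j)
              × β zero ≈ β (suc y) * - s
          r = reduce M dβ (λ j e p → supp (suc j) (α-unsupported M p e))

          t : Coeffs m
          t = proj₁ (proj₁ r)

          t-spec : ∀ j → β (suc j) ≈ β (suc y) * α M (suc j) + t (lab j) * w j
          t-spec = proj₂ (proj₁ r)

          tw≈0 : ∀ j → t (lab j) * w j ≈ 0#
          tw≈0 j with w-split j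
          ... | inj₁ e = trans (*-congˡ e) (zeroʳ _)
          ... | inj₂ wj>0 with attained j wj>0
          ... | p , (labp , wp>0) , ρp≈M = trans (*-congʳ t≈0) (zeroˡ _)
            where
            αp≈0 : α M (suc p) ≈ 0#
            αp≈0 = α-tight M wp>0 (trans ρp≈M (reflexive (≡.cong M (≡.sym labp))))
            t≈0 : t (lab j) ≈ 0#
            t≈0 = trans (reflexive (≡.cong t (≡.sym labp))) (*-cancelʳ-0 (pos⇒≉0 wp>0) (begin
              t (lab p) * w p                                    ≈⟨ +-identityˡ _ ⟨
              0# + t (lab p) * w p                               ≈⟨ +-congʳ (trans (*-congˡ αp≈0) (zeroʳ _)) ⟨
              β (suc y) * α M (suc p) + t (lab p) * w p          ≈⟨ t-spec p ⟨
              β (suc p)                                          ≈⟨ supp (suc p) αp≈0 ⟩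
              0#                                                 ∎))
              where open import Relation.Binary.Reasoning.Setoid setoid

      record Peak (a : Fin m) : Set (c ⊔ ℓ₁ ⊔ ℓ₂) where
        field
          value : Carrier
          bound : ∀ j → Block a j → ρ j ≤ value
          attained : ∀ j → Block a j → ∃[ p ] (Block a p × ρ p ≈ value)

      abstract
        peak : ∀ a → Peak a
        peak a with argmax (block? a) ρ
        ... | inj₁ none = record
          -- A label that names no block: the value is arbitrary and both properties are vacuous.
          { value = 0# ; bound = λ j b → ⊥-elim (none j b) ; attained = λ j b → ⊥-elim (none j b) }
        ... | inj₂ (p , bp , max) = record
          { value = ρ p ; bound = max ; attained = λ _ _ → p , bp , refl }

      M : Coeffs m
      M a = Peak.value (peak a)

      -- The ratios are not constant on such a block, so `α M` does not vanish on all of it; these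
      -- are the blocks to be replaced.
      Merged : Fin m → Set ℓ₂
      Merged a = ∃[ r ] (Block a r × ρ r < M a)

      merged? : ∀ a → Dec (Merged a)
      merged? a = any? (λ r → block? a r ×-dec (ρ r <? M a))

      -- Lowering M on the block a to its second largest ratio ρ r makes both p and q negative,
      -- while x and y stay positive.
      peak-unique : ∀ {a} → Merged a → ∀ p q → Block a p → Block a q → ρ p ≈ M a → ρ q ≈ M a → p ≡ q
      peak-unique {a} (r₀ , br₀ , r₀<) p q bp bq ep eq
        with p ≟ q | argmax (λ r → block? a r ×-dec (ρ r <? M a)) ρ
      ... | yes p≡q | _ = p≡q
      ... | no _ | inj₁ none = ⊥-elim (none r₀ (br₀ , r₀<))
      ... | no p≢q | inj₂ (r , (br , r<) , max) = ⊥-elim (noBad (α M′) (circuit M′ attained)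
          ((zero , suc y , (λ ()) , -s>0 , <-respʳ-≈ (sym (α-y M′)) 0<1) ,
           (suc p , suc q , (λ e → p≢q (suc-injective e)) , negative p bp ep , negative q bq eq)))
        where
        M′ : Coeffs m
        M′ b with b ≟ a
        ... | yes _ = ρ r
        ... | no _ = M b

        M′-a : M′ a ≈ ρ r
        M′-a with a ≟ a
        ... | yes _ = refl
        ... | no e = ⊥-elim (e ≡.refl)

        attained : ∀ j → 0# < w j → ∃[ k ] (Block (lab j) k × ρ k ≈ M′ (lab j))
        attained j wj>0 with lab j ≟ a
        ... | yes e = r , (≡.trans (proj₁ br) (≡.sym e) , proj₂ br) , refl
        ... | no _ = Peak.attained (peak (lab j)) j (≡.refl , wj>0)

        negative : ∀ k → Block a k → ρ k ≈ M a → α M′ (suc k) < 0#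
        negative k (labk , wk>0) e = <-respˡ-≈ (sym (α-≢y M′ (pos⇒≢y wk>0))) (*-neg-pos
          (<-respˡ-≈ (+-congʳ (sym (trans (reflexive (≡.cong M′ labk)) M′-a)))
            (-pos⇒neg (<-respʳ-≈ (solve 2 (λ x y → x :+ :- y := :- (y :+ :- x)) refl (ρ k) (ρ r))
              (<⇒0<- (<-respʳ-≈ (sym e) r<)))))
          wk>0)

      choose : ∀ {p} {P : Set p} → Dec P → Carrier → Carrier → Carrier
      choose (yes _) x y = x
      choose (no _) x y = y

      -- Since `w y` is zero, `y` receives weight one. A peak of a merged block receives weight zero
      -- and so ceases to be a vertex.
      W : Coeffs m
      W j = δ y j + choose (merged? (lab j)) (M (lab j) + - ρ j) 1# * w j

      L : Fin m → Fin (suc m)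
      L j with y ≟ j | merged? (lab j)
      ... | yes _ | _ = zero
      ... | no _ | yes _ = zero
      ... | no _ | no _ = suc (lab j)

      data View (j : Fin m) : Set (c ⊔ ℓ₁ ⊔ ℓ₂) where
        apex : y ≡ j → L j ≡ zero → W j ≈ 1# → View j
        merged : y ≢ j → Merged (lab j) → L j ≡ zero → W j ≈ (M (lab j) + - ρ j) * w j → View j
        live : y ≢ j → ¬ Merged (lab j) → L j ≡ suc (lab j) → W j ≈ w j → View j

      abstract
        view : ∀ j → View j
        view j with y ≟ j in eq | merged? (lab j) in eq′
        ... | yes p | _ = apex p L≡ (trans (+-cong (δ-≡ p) (trans (*-congˡ (trans (reflexive (≡.cong w (≡.sym p))) wy≈0)) (zeroʳ _))) (+-identityʳ 1#))
          where
          L≡ : L j ≡ zero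
          L≡ rewrite eq = ≡.refl
        ... | no p | yes mg = merged p mg L≡ W≈
          where
          L≡ : L j ≡ zero
          L≡ rewrite eq | eq′ = ≡.refl
          W≈ : W j ≈ (M (lab j) + - ρ j) * w j
          W≈ rewrite eq′ = trans (+-congʳ (δ-≢ p)) (+-identityˡ _)
        ... | no p | no ¬mg = live p ¬mg L≡ W≈
          where
          L≡ : L j ≡ suc (lab j)
          L≡ rewrite eq | eq′ = ≡.refl
          W≈ : W j ≈ w j
          W≈ rewrite eq′ = trans (+-cong (δ-≢ p) (*-identityˡ _)) (+-identityˡ _)

      -- On a block that is not merged, every ratio equals the peak.
      live-tight : ∀ {j} → ¬ Merged (lab j) → y ≢ j → α M (suc j) ≈ 0#
      live-tight {j} ¬mg y≢j with w-split j
      ... | inj₁ e = α-unsupported M y≢j e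
      ... | inj₂ wj>0 with Peak.bound (peak (lab j)) j (≡.refl , wj>0)
      ... | inj₁ ρ< = ⊥-elim (¬mg (j , (≡.refl , wj>0) , ρ<))
      ... | inj₂ e = α-tight M wj>0 e

      w⁺ : Coeffs (suc m)
      w⁺ = - s ∷ W

      lab⁺ : Fin (suc m) → Fin (suc m)
      lab⁺ = zero ∷ L

      W≥0 : ∀ j → 0# ≤ W j
      W≥0 j with view j
      ... | apex _ _ e = ≤-respʳ (sym e) (inj₁ 0<1)
      ... | live _ _ _ e = ≤-respʳ (sym e) (w≥0 j)
      ... | merged _ _ _ e with w-split j
      ... | inj₁ e′ = inj₂ (sym (trans e (trans (*-congˡ e′) (zeroʳ _))))
      ... | inj₂ wj>0 = ≤-respʳ (sym e)
        (*-nonneg (≤⇒0≤- (Peak.bound (peak (lab j)) j (≡.refl , wj>0))) (inj₁ wj>0))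

      W-unsupported : ∀ j → w j ≈ 0# → y ≢ j → W j ≈ 0#
      W-unsupported j e y≢j with view j
      ... | apex p _ _ = ⊥-elim (y≢j p)
      ... | merged _ _ _ eW = trans eW (trans (*-congˡ e) (zeroʳ _))
      ... | live _ _ _ eW = trans eW e

      -- The weights labelled `zero` are the coefficients of `α M`, and live blocks keep their old
      -- dependency; `u` removes the old factors of merged blocks.
      closed⁺ : ∀ (t : Coeffs (suc m)) → D (λ i → t (lab⁺ i) * w⁺ i)
      closed⁺ t = resp (λ { zero → +-identityˡ _ ; (suc j) → pointwise j }) (closed₀ u ⊕ t zero · Dα M)
        where
        u : Coeffs m
        u a = choose (merged? a) 0# (t (suc a))

        u-merged : ∀ {a} → Merged a → u a ≈ 0#
        u-merged {a} mg with merged? a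
        ... | yes _ = refl
        ... | no ¬mg = ⊥-elim (¬mg mg)

        u-live : ∀ {a} → ¬ Merged a → u a ≈ t (suc a)
        u-live {a} ¬mg with merged? a
        ... | yes mg = ⊥-elim (¬mg mg)
        ... | no _ = refl

        pointwise : ∀ j → u (lab j) * w j + t zero * α M (suc j) ≈ t (L j) * W j
        pointwise j with view j
        ... | apex ≡.refl eL eW = trans
          (+-cong (trans (*-congˡ wy≈0) (zeroʳ _)) (*-congˡ (α-y M)))
          (trans (+-identityˡ _) (*-cong (reflexive (≡.cong t (≡.sym eL))) (sym eW)))
        ... | merged p mg eL eW = trans
          (+-cong (trans (*-congʳ (u-merged mg)) (zeroˡ _)) (*-congˡ (α-≢y M p)))
          (trans (+-identityˡ _) (*-cong (reflexive (≡.cong t (≡.sym eL))) (sym eW)))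
        ... | live p ¬mg eL eW = trans
          (+-cong (*-congʳ (u-live ¬mg)) (trans (*-congˡ (live-tight ¬mg p)) (zeroʳ _)))
          (trans (+-identityʳ _) (*-cong (reflexive (≡.cong t (≡.sym eL))) (sym eW)))

      rigid⁺ : ∀ β → Supp β w⁺ → D β → Σ (Coeffs (suc m)) λ t → ∀ i → β i ≈ t (lab⁺ i) * w⁺ i
      rigid⁺ β supp dβ = b ∷ t , λ { zero → proj₂ r ; (suc j) → pointwise j }
        where
        b : Carrier
        b = β (suc y)

        r : (Σ (Coeffs m) λ t → ∀ j → β (suc j) ≈ β (suc y) * α M (suc j) + t (lab j) * w j)
            × β zero ≈ β (suc y) * - s
        r = reduce M dβ (λ j e p → supp (suc j) (W-unsupported j e p))

        t : Coeffs m
        t = proj₁ (proj₁ r)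

        t-spec : ∀ j → β (suc j) ≈ b * α M (suc j) + t (lab j) * w j
        t-spec = proj₂ (proj₁ r)

        -- At the discarded peak both the given relation and `α M` vanish, which leaves no room for
        -- a multiple of the old block dependency.
        t-merged : ∀ {j} → Merged (lab j) → 0# < w j → t (lab j) ≈ 0#
        t-merged {j} mg wj>0 with Peak.attained (peak (lab j)) j (≡.refl , wj>0)
        ... | p , (labp , wp>0) , ρp≈M =
          trans (reflexive (≡.cong t (≡.sym labp))) (*-cancelʳ-0 (pos⇒≉0 wp>0) (begin
            t (lab p) * w p                            ≈⟨ +-identityˡ _ ⟨
            0# + t (lab p) * w p                       ≈⟨ +-congʳ (trans (*-congˡ αp≈0) (zeroʳ _)) ⟨
            b * α M (suc p) + t (lab p) * w p          ≈⟨ t-spec p ⟨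
            β (suc p)                                  ≈⟨ supp (suc p) Wp≈0 ⟩
            0#                                         ∎))
          where
          open import Relation.Binary.Reasoning.Setoid setoid
          αp≈0 : α M (suc p) ≈ 0#
          αp≈0 = α-tight M wp>0 (trans ρp≈M (reflexive (≡.cong M (≡.sym labp))))
          Wp≈0 : W p ≈ 0#
          Wp≈0 with view p
          ... | apex e _ _ = ⊥-elim (pos⇒≢y wp>0 e)
          ... | merged y≢p _ _ eW = trans eW (trans (sym (α-≢y M y≢p)) αp≈0)
          ... | live _ ¬mg _ _ = ⊥-elim (¬mg (≡.subst Merged (≡.sym labp) mg))

        pointwise : ∀ j → β (suc j) ≈ (b ∷ t) (L j) * W j
        pointwise j with view j
        ... | apex ≡.refl eL eW = trans (sym (*-identityʳ b))
          (*-cong (reflexive (≡.cong (b ∷ t) (≡.sym eL))) (sym eW))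
        ... | live p ¬mg eL eW = trans (t-spec j) (trans
          (+-congʳ (trans (*-congˡ (live-tight ¬mg p)) (zeroʳ b)))
          (trans (+-identityˡ _) (*-cong (reflexive (≡.cong (b ∷ t) (≡.sym eL))) (sym eW))))
        ... | merged p mg eL eW = trans (t-spec j) (trans
          (+-cong (*-congˡ (α-≢y M p)) tw≈0)
          (trans (+-identityʳ _) (*-cong (reflexive (≡.cong (b ∷ t) (≡.sym eL))) (sym eW))))
          where
          tw≈0 : t (lab j) * w j ≈ 0#
          tw≈0 with w-split j
          ... | inj₁ e = trans (*-congˡ e) (zeroʳ _)
          ... | inj₂ wj>0 = trans (*-congʳ (t-merged mg wj>0)) (zeroˡ _)

      -- A multiple of a merged block's old dependency clears the coefficient at one chosen vertex.
      -- By `peak-unique` only one vertex of the block was discarded, so the remaining points span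
      -- as much as before.
      shift-support : ∀ (β γ : Coeffs (suc m)) → Supp (λ j → γ (suc j)) w → D (λ i → γ i + - β i) →
                      Σ (Coeffs (suc m)) λ γ′ → Supp γ′ w⁺ × D (λ i → γ′ i + - β i)
      shift-support β γ supp dγ = γ′ , supp′ , resp
        (λ { zero → solve 2 (λ x y → (x :+ :- y) :+ (:- :1) :* :0 := x :+ :- y) refl (γ zero) (β zero)
           ; (suc j) → solve 3 (λ x y z → (x :+ :- y) :+ (:- :1) :* z := (x :+ :- z) :+ :- y) refl
               (γ (suc j)) (β (suc j)) (t (lab j) * w j) })
        (dγ ⊕ - 1# · closed₀ t)
        where
        top : ∀ {a} → Merged a → ∃[ p ] (Block a p × ρ p ≈ M a)
        top {a} (r , br , _) = Peak.attained (peak a) r br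

        t : Coeffs m
        t a with merged? a
        ... | yes mg = γ (suc (proj₁ (top mg))) * w (proj₁ (top mg)) ⁻¹
        ... | no _ = 0#

        t-top : ∀ j → Merged (lab j) → 0# < w j → ρ j ≈ M (lab j) → t (lab j) * w j ≈ γ (suc j)
        t-top j mg wj>0 e with merged? (lab j)
        ... | no ¬mg = ⊥-elim (¬mg mg)
        ... | yes mg′ with top mg′
        ... | p , bp , ρp≈M with peak-unique mg′ p j bp (≡.refl , wj>0) ρp≈M e
        ... | ≡.refl = trans (*-assoc _ _ _) (trans (*-congˡ (⁻¹-inverseˡ (pos⇒≉0 wj>0))) (*-identityʳ _))

        γ′ : Coeffs (suc m)
        γ′ = γ zero ∷ (λ j → γ (suc j) + - (t (lab j) * w j))

        vanish : ∀ j → w j ≈ 0# → γ (suc j) + - (t (lab j) * w j) ≈ 0#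
        vanish j e = trans (+-cong (supp j e) (-‿cong (trans (*-congˡ e) (zeroʳ _)))) (-‿inverseʳ 0#)

        supp′ : Supp γ′ w⁺
        supp′ zero e = contradiction e (pos⇒≉0 -s>0)
        supp′ (suc j) e with view j
        ... | apex _ _ eW = ⊥-elim (1≉0 (trans (sym eW) e))
        ... | live _ _ _ eW = vanish j (trans (sym eW) e)
        ... | merged _ mg _ eW with w-split j
        ... | inj₁ e′ = vanish j e′
        ... | inj₂ wj>0 = trans (+-congˡ (-‿cong (t-top j mg wj>0 ρ≈M))) (-‿inverseʳ _)
          where
          ρ≈M : ρ j ≈ M (lab j)
          ρ≈M = trans (solve 2 (λ x y → x := y :+ :- (y :+ :- x)) refl (ρ j) (M (lab j)))
            (trans (+-congˡ (-‿cong (*-cancelʳ-0 (pos⇒≉0 wj>0) (trans (sym eW) e))))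
              (solve 1 (λ x → x :+ :- :0 := x) refl (M (lab j))))

      span⁺ : ∀ i → Σ (Coeffs (suc m)) λ β → Supp β w⁺ × D (λ j → β j + - δ i j)
      span⁺ zero = shift-support (δ zero) (δ zero) (λ j _ → δ-≢ {i = zero} {suc j} λ ())
        (resp (λ i → sym (-‿inverseʳ _)) null)
      span⁺ (suc i) = shift-support (δ (suc i)) (height i ∷ base i) (base-supp i)
        (resp (λ { zero → trans (solve 1 (λ x → x := x :+ :- :0) refl (height i))
                            (+-congˡ (-‿cong (sym (δ-≢ {i = suc i} {zero} λ ()))))
                 ; (suc j) → +-congˡ (-‿cong (sym (δ-suc i j))) }) (D-height i))

      partner⁺ : ∀ i → 0# < w⁺ i → ∃[ j ] (j ≢ i × lab⁺ j ≡ lab⁺ i × 0# < w⁺ j)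
      partner⁺ zero _ with view y
      ... | apex _ eL eW = suc y , (λ ()) , eL , <-respʳ-≈ (sym eW) 0<1
      ... | merged p _ _ _ = ⊥-elim (p ≡.refl)
      ... | live p _ _ _ = ⊥-elim (p ≡.refl)
      partner⁺ (suc j) W>0 with view j
      ... | apex _ eL _ = zero , (λ ()) , ≡.sym eL , -s>0
      ... | merged _ _ eL _ = zero , (λ ()) , ≡.sym eL , -s>0
      ... | live _ ¬mg eL eW with partner j (<-respʳ-≈ eW W>0)
      ... | k , k≢j , labk , wk>0 with view k
      ... | apex e _ _ = ⊥-elim (pos⇒≢y wk>0 e)
      ... | merged _ mg _ _ = ⊥-elim (¬mg (≡.subst Merged labk mg))
      ... | live _ _ eL′ eW′ = suc k , (λ e → k≢j (suc-injective e)) ,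
        ≡.trans eL′ (≡.trans (≡.cong suc labk) (≡.sym eL)) , <-respʳ-≈ (sym eW′) wk>0

      merge : Skeletal D
      merge = record
        { w = w⁺
        ; w≥0 = λ { zero → inj₁ -s>0 ; (suc j) → W≥0 j }
        ; lab = lab⁺
        ; closed = closed⁺
        ; rigid = rigid⁺
        ; span = span⁺
        ; partner = partner⁺
        }

  -- A redundant point is only reported: its removal calls for a skeleton of the family without it,
  -- which the contraction does not provide.
  extend : ∀ {m} {D : Coeffs (suc m) → Set ℓ₁} {D′ : Coeffs m → Set ℓ₁} →
           Subspace D → Contraction D D′ → NoBadCircuit D →
           ∀ {μ : Coeffs (suc m)} → (∀ i → 0# < μ i) → D μ → Skeletal D′ →
           Skeletal D ⊎ (Σ (Coeffs m) λ ν → (∀ j → 0# ≤ ν j) × D (- 1# ∷ ν))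
  extend {m} {D} subspace contraction noBad μ>0 Dμ skeletal
    with any? (λ a → Extend.l subspace contraction noBad skeletal a <? 0#)
  ... | yes (a , la<0) = inj₂ (Extend.redundant subspace contraction noBad skeletal a la<0)
  ... | no none with any? (λ a → 0# <? Extend.l subspace contraction noBad skeletal a)
  ... | yes (a , la>0) = inj₁ (join-block a la>0 others)
    where
    open Extend subspace contraction noBad skeletal
    others : ∀ b → b ≢ a → l b ≈ 0#
    others b b≢a with compare (l b) 0#
    ... | tri< p _ _ = ⊥-elim (none (b , p))
    ... | tri≈ _ e _ = e
    ... | tri> _ _ p = ⊥-elim (¬two-positive b≢a p la>0)
  ... | no none′ = inj₁ (merge (proj₁ apex-below) (proj₂ apex-below))
    where
    open Extend subspace contraction noBad skeletal using (l)
    l≈0 : ∀ a → l a ≈ 0#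
    l≈0 a with compare (l a) 0#
    ... | tri< p _ _ = ⊥-elim (none (a , p))
    ... | tri≈ _ e _ = e
    ... | tri> _ _ p = ⊥-elim (none′ (a , p))
    open Merge subspace contraction noBad skeletal l≈0
    apex-below : ∃[ y ] (height y < 0#)
    apex-below = below-hyperplane μ>0 Dμ

  -- Vector families: contraction, deletion and the induction

  Dep : ∀ {n m} → (Fin m → Vect F n) → Coeffs m → Set ℓ₁
  Dep X β = ∀ k → Σ[ (λ i → β i * X i k) ] ≈ 0#

  Dep-subspace : ∀ {n m} (X : Fin m → Vect F n) → Subspace (Dep X)
  Dep-subspace {n} {m} X = record
    { resp = λ e d k → trans (Σ-cong {m} (λ i → *-congʳ (sym (e i)))) (d k)
    ; null = λ k → Σ-zero {m} (λ i → zeroˡ (X i k))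
    ; _⊕_·_ = add
    }
    where
    add : ∀ {β γ} → Dep X β → ∀ a → Dep X γ → Dep X (λ i → β i + a * γ i)
    add {β} {γ} dβ a dγ k = begin
      Σ[ (λ i → (β i + a * γ i) * X i k) ]                      ≈⟨ Σ-cong {m} (λ i → solve 4
        (λ b a g x → (b :+ a :* g) :* x := b :* x :+ a :* (g :* x)) refl (β i) a (γ i) (X i k)) ⟩
      Σ[ (λ i → β i * X i k + a * (γ i * X i k)) ]              ≈⟨ Σ-+ (λ i → β i * X i k) (λ i → a * (γ i * X i k)) ⟩
      Σ[ (λ i → β i * X i k) ] + Σ[ (λ i → a * (γ i * X i k)) ] ≈⟨ +-cong (dβ k) (trans (Σ-*ˡ a (λ i → γ i * X i k)) (*-congˡ (dγ k))) ⟩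
      0# + a * 0#                                               ≈⟨ trans (+-identityˡ _) (zeroʳ a) ⟩
      0#                                                        ∎
      where open import Relation.Binary.Reasoning.Setoid setoid

  -- The lift of a circuit is a circuit, because the coefficient of the contracted point is
  -- determined by the others.
  contraction-noBad : ∀ {m} {D : Coeffs (suc m) → Set ℓ₁} {D′ : Coeffs m → Set ℓ₁} →
                      Subspace D → Contraction D D′ → NoBadCircuit D → NoBadCircuit D′
  contraction-noBad {m} {D} {D′} subspace contraction noBad α (dα , multiple)
    ((p , q , p≢q , αp , αq) , (p′ , q′ , p′≢q′ , αp′ , αq′)) =
    noBad (a ∷ α) (Daα , multiple′)
      ((suc p , suc q , (λ e → p≢q (suc-injective e)) , αp , αq) ,
       (suc p′ , suc q′ , (λ e → p′≢q′ (suc-injective e)) , αp′ , αq′))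
    where
    open Subspace subspace
    open Contraction contraction

    a : Carrier
    a = proj₁ (lift dα)

    Daα : D (a ∷ α)
    Daα = proj₂ (lift dα)

    multiple′ : ∀ β → Supp β (a ∷ α) → D β → ∃[ s ] (∀ i → β i ≈ s * (a ∷ α) i)
    multiple′ β supp dβ = s , λ { zero → head ; (suc j) → proj₂ r j }
      where
      r : ∃[ s ] (∀ i → β (suc i) ≈ s * α i)
      r = multiple (λ j → β (suc j)) (λ j → supp (suc j)) (drop dβ)

      s : Carrier
      s = proj₁ r

      head : β zero ≈ s * a
      head = trans (solve 3 (λ b s a → b := (b :+ (:- s) :* a) :+ s :* a) refl (β zero) s a)
        (trans (+-congʳ (nonloop (dβ ⊕ - s · Daα) λ j → trans (+-congʳ (proj₂ r j))
          (solve 2 (λ s a → s :* a :+ (:- s) :* a := :0) refl s (α j)))) (+-identityˡ _))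

  module Pivot {n m} (X : Fin (suc m) → Vect F n) (k₀ : Fin n) (X₀≉0 : ¬ (X zero k₀ ≈ 0#)) where

    r : Carrier
    r = X zero k₀ ⁻¹

    -- Each point is changed by a multiple of the contracted one that clears coordinate `k₀`. The
    -- ambient dimension stays `n`, so a skeleton of the quotient is asked to span only the points
    -- of the quotient.
    quotient : Fin m → Vect F n
    quotient i k = X (suc i) k + - (X (suc i) k₀ * r) * X zero k

    quotient-Σ : ∀ (β : Coeffs m) k → Σ[ (λ i → β i * quotient i k) ] ≈
      Σ[ (λ i → β i * X (suc i) k) ] + Σ[ (λ i → β i * X (suc i) k₀) ] * - (r * X zero k)
    quotient-Σ β k = trans
      (Σ-cong {m} (λ i → solve 5 (λ b x y r z → b :* (x :+ (:- (y :* r)) :* z) := b :* x :+ (b :* y) :* (:- (r :* z)))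
        refl (β i) (X (suc i) k) (X (suc i) k₀) r (X zero k)))
      (trans (Σ-+ (λ i → β i * X (suc i) k) (λ i → β i * X (suc i) k₀ * - (r * X zero k)))
        (+-congˡ (Σ-*ʳ (λ i → β i * X (suc i) k₀) _)))

    contraction : Contraction (Dep X) (Dep quotient)
    contraction = record
      -- This coefficient of the contracted point makes coordinate `k₀` cancel.
      { lift = λ {β} d → - (Σ[ (λ i → β i * X (suc i) k₀) ] * r) , λ k → trans
          (solve 4 (λ S r x T → (:- (S :* r)) :* x :+ T := T :+ S :* (:- (r :* x))) refl
            (Σ[ (λ i → β i * X (suc i) k₀) ]) r (X zero k) (Σ[ (λ i → β i * X (suc i) k) ]))
          (trans (sym (quotient-Σ β k)) (d k))
      ; drop = λ {β} → drop {β}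
      ; nonloop = λ {β} d e → *-cancelʳ-0 X₀≉0 (trans (sym (+-identityʳ _))
          (trans (+-congˡ (sym (Σ-zero {m} (λ j → trans (*-congʳ (e j)) (zeroˡ _))))) (d k₀)))
      }
      where
      drop : ∀ {β} → Dep X β → Dep quotient (λ j → β (suc j))
      drop {β} d k = begin
        Σ[ (λ i → β (suc i) * quotient i k) ]      ≈⟨ quotient-Σ (λ i → β (suc i)) k ⟩
        T + S * - (r * X zero k)                   ≈⟨ solve 6 (λ T S r x b y → T :+ S :* (:- (r :* x)) :=
                                                        ((b :* x :+ T) :+ (:- (r :* x)) :* (b :* y :+ S))
                                                        :+ b :* x :* (r :* y :+ :- :1))
                                                        refl T S r (X zero k) (β zero) (X zero k₀) ⟩
        ((β zero * X zero k + T) + - (r * X zero k) * (β zero * X zero k₀ + S))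
          + β zero * X zero k * (r * X zero k₀ + - 1#)
                                                   ≈⟨ +-cong (+-cong (d k) (*-congˡ (d k₀)))
                                                        (*-congˡ (+-congʳ (⁻¹-inverseˡ X₀≉0))) ⟩
        (0# + - (r * X zero k) * 0#) + β zero * X zero k * (1# + - 1#)
                                                   ≈⟨ solve 2 (λ x y → (:0 :+ x :* :0) :+ y :* (:1 :+ :- :1) := :0) refl
                                                        (- (r * X zero k)) (β zero * X zero k) ⟩
        0#                                         ∎
        where
        open import Relation.Binary.Reasoning.Setoid setoid
        S T : Carrier
        S = Σ[ (λ i → β (suc i) * X (suc i) k₀) ]
        T = Σ[ (λ i → β (suc i) * X (suc i) k) ]

  module Deletion {n m} (X : Fin (suc m) → Vect F n)
    {ν : Coeffs m} (ν≥0 : ∀ j → 0# ≤ ν j) (Dν : Dep X (- 1# ∷ ν)) where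

    rest : Fin m → Vect F n
    rest i = X (suc i)

    restrict : ∀ {β} → β zero ≈ 0# → Dep X β → Dep rest (λ j → β (suc j))
    restrict e d k = trans (sym (trans (+-congʳ (trans (*-congʳ e) (zeroˡ _))) (+-identityˡ _))) (d k)

    pad : ∀ {β} → Dep rest β → Dep X (0# ∷ β)
    pad d k = trans (+-congʳ (zeroˡ _)) (trans (+-identityˡ _) (d k))

    noBad-rest : NoBadCircuit (Dep X) → NoBadCircuit (Dep rest)
    noBad-rest noBad α (dα , multiple) ((p , q , p≢q , αp , αq) , (p′ , q′ , p′≢q′ , αp′ , αq′)) =
      noBad (0# ∷ α) (pad {α} dα , multiple′)
        ((suc p , suc q , (λ e → p≢q (suc-injective e)) , αp , αq) ,
         (suc p′ , suc q′ , (λ e → p′≢q′ (suc-injective e)) , αp′ , αq′))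
      where
      multiple′ : ∀ β → Supp β (0# ∷ α) → Dep X β → ∃[ s ] (∀ i → β i ≈ s * (0# ∷ α) i)
      multiple′ β supp dβ
        with multiple (λ j → β (suc j)) (λ j → supp (suc j)) (restrict {β} (supp zero refl) dβ)
      ... | s , e = s , λ { zero → trans (supp zero refl) (sym (zeroʳ s)) ; (suc j) → e j }

    -- The weight of the removed point is passed to its nonnegative representation `ν`, which lowers
    -- no other weight.
    positive-rest : ∀ {μ : Coeffs (suc m)} → (∀ i → 0# < μ i) → Dep X μ →
                    Σ (Coeffs m) λ μ′ → (∀ i → 0# < μ′ i) × Dep rest μ′
    positive-rest {μ} μ>0 Dμ = (λ j → μ (suc j) + μ zero * ν j) ,
      (λ j → +-pos-nonneg (μ>0 (suc j)) (*-nonneg (inj₁ (μ>0 zero)) (ν≥0 j))) ,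
      restrict {λ i → μ i + μ zero * (- 1# ∷ ν) i}
        (solve 1 (λ x → x :+ x :* (:- :1) := :0) refl (μ zero))
        (Subspace._⊕_·_ (Dep-subspace X) {μ} {(- 1#) ∷ ν} Dμ (μ zero) Dν)

    -- The removed point is no vertex; it is spanned because `ν` expresses it by points that are.
    skeletal-X : Skeletal (Dep rest) → Skeletal (Dep X)
    skeletal-X skeletal = record
      { w = 0# ∷ w
      ; w≥0 = λ { zero → inj₂ refl ; (suc j) → w≥0 j }
      ; lab = lab′
      ; closed = λ t → X.resp {0# ∷ (λ j → t (suc (lab j)) * w j)} {λ i → t (lab′ i) * (0# ∷ w) i}
          (λ { zero → sym (zeroʳ (t zero)) ; (suc j) → refl })
          (pad {λ j → t (suc (lab j)) * w j} (closed (λ a → t (suc a))))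
      ; rigid = rigid′
      ; span = span′
      ; partner = partner′
      }
      where
      open Skeletal skeletal
      module X = Subspace (Dep-subspace X)
      module R = Subspace (Dep-subspace rest)

      lab′ : Fin (suc m) → Fin (suc m)
      lab′ = zero ∷ (λ j → suc (lab j))

      rigid′ : ∀ β → Supp β (0# ∷ w) → Dep X β →
               Σ (Coeffs (suc m)) λ t → ∀ i → β i ≈ t (lab′ i) * (0# ∷ w) i
      rigid′ β supp dβ with rigid (λ j → β (suc j)) (λ j → supp (suc j)) (restrict {β} (supp zero refl) dβ)
      ... | t , e = 0# ∷ t , λ { zero → trans (supp zero refl) (sym (zeroʳ 0#)) ; (suc j) → e j }

      β : Fin m → Coeffs m
      β i = proj₁ (span i)

      βν : Coeffs m
      βν j = Σ[ (λ i → ν i * β i j) ]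

      relation : Coeffs (suc m)
      relation i = (- 1# ∷ ν) i + 1# * (0# ∷ (λ j → Σ[ (λ i → ν i * (β i j + - δ i j)) ])) i

      Dβν : Dep X relation
      Dβν = X._⊕_·_ {(- 1#) ∷ ν} {0# ∷ (λ j → Σ[ (λ i → ν i * (β i j + - δ i j)) ])} Dν 1# (pad {λ j → Σ[ (λ i → ν i * (β i j + - δ i j)) ]} (R.sum ν (λ i j → β i j + - δ i j) (λ i → proj₂ (proj₂ (span i)))))

      span′ : ∀ i → Σ (Coeffs (suc m)) λ β → Supp β (0# ∷ w) × Dep X (λ j → β j + - δ i j)
      span′ zero = 0# ∷ βν ,
        (λ { zero e → e
           ; (suc j) e → Σ-zero {m} (λ i → trans (*-congˡ (proj₁ (proj₂ (span i)) j e)) (zeroʳ (ν i))) }) ,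
        X.resp {relation} {λ j → (0# ∷ βν) j + - δ zero j}
          (λ { zero → trans (solve 0 (:- :1 :+ :1 :* :0 := :0 :+ :- :1) refl)
                             (+-congˡ (-‿cong (sym (δ-refl {suc m} zero))))
                  ; (suc j) → suc-entry j }) Dβν
        where
        open import Relation.Binary.Reasoning.Setoid setoid
        suc-entry : ∀ j → ν j + 1# * Σ[ (λ i → ν i * (β i j + - δ i j)) ] ≈ βν j + - δ zero (suc j)
        suc-entry j = begin
          ν j + 1# * Σ[ (λ i → ν i * (β i j + - δ i j)) ]
            ≈⟨ +-congˡ (*-congˡ (Σ-cong {m} (λ i → solve 3 (λ n b d → n :* (b :+ :- d) := n :* b :+ (:- :1) :* (n :* d))
                 refl (ν i) (β i j) (δ i j)))) ⟩
          ν j + 1# * Σ[ (λ i → ν i * β i j + - 1# * (ν i * δ i j)) ]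
            ≈⟨ +-congˡ (*-congˡ (trans (Σ-+ (λ i → ν i * β i j) (λ i → - 1# * (ν i * δ i j)))
                 (+-congˡ (trans (Σ-*ˡ (- 1#) (λ i → ν i * δ i j)) (*-congˡ (Σ-δʳ ν j)))))) ⟩
          ν j + 1# * (βν j + - 1# * ν j)
            ≈⟨ solve 2 (λ n b → n :+ :1 :* (b :+ (:- :1) :* n) := b :+ :- :0) refl (ν j) (βν j) ⟩
          βν j + - 0#
            ≈⟨ +-congˡ (-‿cong (sym (δ-≢ {i = zero} {suc j} λ ()))) ⟩
          βν j + - δ zero (suc j) ∎
      span′ (suc i) = 0# ∷ β i ,
        (λ { zero e → e ; (suc j) → proj₁ (proj₂ (span i)) j }) ,
        X.resp {0# ∷ (λ j → β i j + - δ i j)} {λ j → (0# ∷ β i) j + - δ (suc i) j}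
          (λ { zero → trans (solve 0 (:0 := :0 :+ :- :0) refl)
                             (+-congˡ (-‿cong (sym (δ-≢ {i = suc i} {zero} λ ()))))
                  ; (suc j) → +-congˡ (-‿cong (sym (δ-suc i j))) })
          (pad {λ j → β i j + - δ i j} (proj₂ (proj₂ (span i))))

      partner′ : ∀ i → 0# < (0# ∷ w) i → ∃[ j ] (j ≢ i × lab′ j ≡ lab′ i × 0# < (0# ∷ w) j)
      partner′ zero p = ⊥-elim (<-irrefl refl p)
      partner′ (suc i) p with partner i p
      ... | j , j≢i , e , q = suc j , (λ e′ → j≢i (suc-injective e′)) , ≡.cong suc e , q

  StrictlyPositive : ∀ {m} → (Coeffs m → Set ℓ₁) → Set (c ⊔ ℓ₁ ⊔ ℓ₂)
  StrictlyPositive {m} D = Σ (Coeffs m) λ μ → (∀ i → 0# < μ i) × D μ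

  HasSkeleton : ℕ → ℕ → Set (c ⊔ ℓ₁ ⊔ ℓ₂)
  HasSkeleton n m = ∀ (X : Fin m → Vect F n) → NoBadCircuit (Dep X) → StrictlyPositive (Dep X) → Skeletal (Dep X)

  module _ {n m} (ih : HasSkeleton n m) (X : Fin (suc m) → Vect F n)
    (noBad : NoBadCircuit (Dep X)) (positive : StrictlyPositive (Dep X)) where

    delete-first : (Σ (Coeffs m) λ ν → (∀ j → 0# ≤ ν j) × Dep X (- 1# ∷ ν)) → Skeletal (Dep X)
    delete-first (ν , ν≥0 , Dν) = skeletal-X
      (ih rest (noBad-rest noBad) (positive-rest (proj₁ (proj₂ positive)) (proj₂ (proj₂ positive))))
      where open Deletion X ν≥0 Dν

    -- Quotients contain zero vectors when some point is a multiple of the contracted one. A zero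
    -- vector is redundant with all coefficients zero.
    delete-zero : (∀ k → X zero k ≈ 0#) → Skeletal (Dep X)
    delete-zero X₀≈0 = delete-first ((λ _ → 0#) , (λ _ → inj₂ refl) ,
      λ k → trans (+-cong (trans (*-congˡ (X₀≈0 k)) (zeroʳ _))
        (Σ-zero {m} (λ j → zeroˡ (X (suc j) k)))) (+-identityˡ 0#))

    contract-first : ∀ k₀ → ¬ (X zero k₀ ≈ 0#) → Skeletal (Dep X)
    contract-first k₀ X₀≉0 = [ (λ sk → sk) , delete-first ]′
      (extend (Dep-subspace X) contraction noBad {μ} (proj₁ (proj₂ positive)) (proj₂ (proj₂ positive)) quotient-skeletal)
      where
      open Pivot X k₀ X₀≉0

      μ : Coeffs (suc m)
      μ = proj₁ positive

      quotient-skeletal : Skeletal (Dep quotient)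
      quotient-skeletal = ih quotient (contraction-noBad (Dep-subspace X) contraction noBad)
        ((λ i → μ (suc i)) , (λ i → proj₁ (proj₂ positive) (suc i)) ,
         Contraction.drop contraction {μ} (proj₂ (proj₂ positive)))

    has-skeleton-step : Skeletal (Dep X)
    has-skeleton-step with any? (λ k → ¬? (X zero k ≈? 0#))
    ... | no X₀≈0 = delete-zero (λ k → decidable-stable (X zero k ≈? 0#) (λ p → X₀≈0 (k , p)))
    ... | yes (k₀ , X₀≉0) = contract-first k₀ X₀≉0

  has-skeleton : ∀ n m → HasSkeleton n m
  has-skeleton n zero X noBad positive = record
    { w = λ () ; w≥0 = λ () ; lab = λ ()
    ; closed = λ t → Subspace.null (Dep-subspace X)
    ; rigid = λ β _ _ → (λ ()) , λ ()
    ; span = λ () ; partner = λ () }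
  has-skeleton n (suc m) X noBad positive = has-skeleton-step (has-skeleton n m) X noBad positive

  -- Extension of a bad circuit to n + 1 points in conical position

  Σ-perturb : ∀ {m} (f : Coeffs m) a p (g : Coeffs m) →
              Σ[ (λ i → (f i + a * δ p i) * g i) ] ≈ Σ[ (λ i → f i * g i) ] + a * g p
  Σ-perturb {m} f a p g = begin
    Σ[ (λ i → (f i + a * δ p i) * g i) ]                     ≈⟨ Σ-cong {m} (λ i → solve 4
      (λ f a d g → (f :+ a :* d) :* g := f :* g :+ a :* (d :* g)) refl (f i) a (δ p i) (g i)) ⟩
    Σ[ (λ i → f i * g i + a * (δ p i * g i)) ]               ≈⟨ Σ-+ (λ i → f i * g i) (λ i → a * (δ p i * g i)) ⟩
    Σ[ (λ i → f i * g i) ] + Σ[ (λ i → a * (δ p i * g i)) ]  ≈⟨ +-congˡ (trans (Σ-*ˡ a (λ i → δ p i * g i)) (*-congˡ (Σ-δˡ p g))) ⟩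
    Σ[ (λ i → f i * g i) ] + a * g p                         ∎
    where open import Relation.Binary.Reasoning.Setoid setoid

  NontrivialSolution : ∀ {m k} → Subset m → (Fin k → Coeffs m) → Set (c ⊔ ℓ₁)
  NontrivialSolution {m} S rows = Σ (Coeffs m) λ x → SupportedOn F S x × (∃[ i ] ¬ (x i ≈ 0#)) ×
    (∀ k → Σ[ (λ i → x i * rows k i) ] ≈ 0#)

  -- Gaussian elimination: the first row either vanishes on `S` and imposes nothing, or has a pivot
  -- that is eliminated from the other rows and recovered afterwards.
  underdetermined : ∀ k {m} (S : Subset m) (rows : Fin k → Coeffs m) → k ℕ.< ∣ S ∣ → NontrivialSolution S rows
  underdetermined zero S rows 0<∣S∣ with ∣∣>0⇒Nonempty S 0<∣S∣
  ... | p , p∈S = δ p , (λ i i∉S → δ-≢ (λ { ≡.refl → i∉S p∈S })) ,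
    (p , λ e → 1≉0 (trans (sym (δ-refl p)) e)) , λ ()
  underdetermined (suc k) {m} S rows k<∣S∣ with any? (λ p → p ∈? S ×-dec ¬? (rows zero p ≈? 0#))
  ... | no none = extend-solution (underdetermined k S (λ j → rows (suc j)) (ℕ.<-trans (ℕ.n<1+n k) k<∣S∣))
    where
    extend-solution : NontrivialSolution S (λ j → rows (suc j)) → NontrivialSolution S rows
    extend-solution (x , supp , x≉0 , sol) = x , supp , x≉0 , λ { zero → Σ-zero term ; (suc j) → sol j }
      where
      term : ∀ i → x i * rows zero i ≈ 0#
      term i with i ∈? S
      ... | no i∉S = trans (*-congʳ (supp i i∉S)) (zeroˡ _)
      ... | yes i∈S = trans (*-congˡ (decidable-stable (rows zero i ≈? 0#) (λ ne → none (i , i∈S , ne)))) (zeroʳ _)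
  ... | yes (p , p∈S , rp≉0) = back-substitute (underdetermined k S′ rows′
      (ℕ.≤-pred (≡.subst (suc k ℕ.<_) (∣remove∣ p∈S) k<∣S∣)))
    where
    S′ : Subset m
    S′ = S [ p ]≔ outside

    r : Coeffs m
    r = rows zero

    rows′ : Fin k → Coeffs m
    rows′ j i = rows (suc j) i + - (rows (suc j) p * r p ⁻¹) * r i

    back-substitute : NontrivialSolution S′ rows′ → NontrivialSolution S rows
    back-substitute (x , supp , (q , xq≉0) , sol) = x′ , supp′ , (q , x′q≉0) , sol′
      where
      open import Relation.Binary.Reasoning.Setoid setoid

      Σxr : Carrier
      Σxr = Σ[ (λ i → x i * r i) ]

      -- The value at `p` that balances the first row; `rows′` is corrected so that the other rows
      -- then balance too.
      a : Carrier
      a = - (Σxr * r p ⁻¹)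

      x′ : Coeffs m
      x′ i = x i + a * δ p i

      p≢q : p ≢ q
      p≢q ≡.refl = xq≉0 (supp p (∉-remove S p))

      supp′ : SupportedOn F S x′
      supp′ i i∉S = trans (+-cong (supp i (∉-remove⁺ {S = S} i∉S)) (*-congˡ (δ-≢ (λ { ≡.refl → i∉S p∈S }))))
        (trans (+-identityˡ _) (zeroʳ a))

      x′q≉0 : ¬ (x′ q ≈ 0#)
      x′q≉0 e = xq≉0 (trans (sym (trans (+-congˡ (trans (*-congˡ (δ-≢ p≢q)) (zeroʳ a))) (+-identityʳ _))) e)

      sol′ : ∀ j → Σ[ (λ i → x′ i * rows j i) ] ≈ 0#
      sol′ zero = begin
        Σ[ (λ i → x′ i * r i) ]               ≈⟨ Σ-perturb x a p r ⟩
        Σxr + - (Σxr * r p ⁻¹) * r p          ≈⟨ solve 3 (λ S i r → S :+ (:- (S :* i)) :* r := S :+ :- (S :* (i :* r))) refl Σxr (r p ⁻¹) (r p) ⟩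
        Σxr + - (Σxr * (r p ⁻¹ * r p))        ≈⟨ +-congˡ (-‿cong (*-congˡ (⁻¹-inverseˡ rp≉0))) ⟩
        Σxr + - (Σxr * 1#)                    ≈⟨ solve 1 (λ S → S :+ :- (S :* :1) := :0) refl Σxr ⟩
        0#                                    ∎
      sol′ (suc j) = begin
        Σ[ (λ i → x′ i * rows (suc j) i) ]
          ≈⟨ Σ-perturb x a p (rows (suc j)) ⟩
        Σ[ (λ i → x i * rows (suc j) i) ] + a * rows (suc j) p
          ≈⟨ solve 4 (λ T S i y → T :+ (:- (S :* i)) :* y := T :+ S :* (:- (y :* i))) refl
               (Σ[ (λ i → x i * rows (suc j) i) ]) Σxr (r p ⁻¹) (rows (suc j) p) ⟩
        Σ[ (λ i → x i * rows (suc j) i) ] + Σxr * - (rows (suc j) p * r p ⁻¹)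
          ≈⟨ +-congˡ (sym (Σ-*ʳ (λ i → x i * r i) _)) ⟩
        Σ[ (λ i → x i * rows (suc j) i) ] + Σ[ (λ i → x i * r i * - (rows (suc j) p * r p ⁻¹)) ]
          ≈⟨ sym (Σ-+ (λ i → x i * rows (suc j) i) (λ i → x i * r i * - (rows (suc j) p * r p ⁻¹))) ⟩
        Σ[ (λ i → x i * rows (suc j) i + x i * r i * - (rows (suc j) p * r p ⁻¹)) ]
          ≈⟨ Σ-cong {m} (λ i → solve 4 (λ x y r z → x :* y :+ x :* r :* z := x :* (y :+ z :* r)) refl
               (x i) (rows (suc j) i) (r i) (- (rows (suc j) p * r p ⁻¹))) ⟩
        Σ[ (λ i → x i * rows′ j i) ]
          ≈⟨ sol j ⟩
        0# ∎

  -- Spanning families and their size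

  Spanning : ∀ {n m} → (Fin m → Vect F n) → Set (c ⊔ ℓ₁)
  Spanning {n} {m} X = ∀ (y : Vect F n) → Σ (Coeffs m) λ μ → ∀ k → Σ[ (λ i → μ i * X i k) ] ≈ y k

  -- `Z` marks the points to avoid. It is arbitrary so as to cover both the complement of a subset
  -- and the zeros of `w`.
  respan : ∀ {n m z} (X : Fin m → Vect F n) {Z : Fin m → Set z} →
           (∀ i → Σ (Coeffs m) λ β → (∀ j → Z j → β j ≈ 0#) × Dep X (λ j → β j + - δ i j)) →
           Spanning X → ∀ y → Σ (Coeffs m) λ γ → (∀ j → Z j → γ j ≈ 0#) × (∀ k → Σ[ (λ i → γ i * X i k) ] ≈ y k)
  respan {n} {m} X {Z} each spanning y = γ , γ-supp , λ k → trans (same k) (proj₂ (spanning y) k)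
    where
    open import Relation.Binary.Reasoning.Setoid setoid
    μ : Coeffs m
    μ = proj₁ (spanning y)

    β : Fin m → Coeffs m
    β i = proj₁ (each i)

    γ : Coeffs m
    γ j = Σ[ (λ i → μ i * β i j) ]

    γ-supp : ∀ j → Z j → γ j ≈ 0#
    γ-supp j z = Σ-zero {m} (λ i → trans (*-congˡ (proj₁ (proj₂ (each i)) j z)) (zeroʳ (μ i)))

    combination : Coeffs m
    combination j = Σ[ (λ i → μ i * (β i j + - δ i j)) ]

    combination≈ : ∀ j → combination j ≈ γ j + - 1# * μ j
    combination≈ j = begin
      Σ[ (λ i → μ i * (β i j + - δ i j)) ]               ≈⟨ Σ-cong {m} (λ i → solve 3
        (λ n b d → n :* (b :+ :- d) := n :* b :+ (:- :1) :* (n :* d)) refl (μ i) (β i j) (δ i j)) ⟩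
      Σ[ (λ i → μ i * β i j + - 1# * (μ i * δ i j)) ]    ≈⟨ Σ-+ (λ i → μ i * β i j) (λ i → - 1# * (μ i * δ i j)) ⟩
      γ j + Σ[ (λ i → - 1# * (μ i * δ i j)) ]            ≈⟨ +-congˡ (trans (Σ-*ˡ (- 1#) (λ i → μ i * δ i j)) (*-congˡ (Σ-δʳ μ j))) ⟩
      γ j + - 1# * μ j                                   ∎

    same : ∀ k → Σ[ (λ i → γ i * X i k) ] ≈ Σ[ (λ i → μ i * X i k) ]
    same k = begin
      Σ[ (λ i → γ i * X i k) ]
        ≈⟨ solve 2 (λ g u → g := (g :+ (:- :1) :* u) :+ u) refl (Σ[ (λ i → γ i * X i k) ]) (Σ[ (λ i → μ i * X i k) ]) ⟩
      (Σ[ (λ i → γ i * X i k) ] + - 1# * Σ[ (λ i → μ i * X i k) ]) + Σ[ (λ i → μ i * X i k) ]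
        ≈⟨ +-congʳ (trans (+-congˡ (sym (Σ-*ˡ (- 1#) (λ i → μ i * X i k))))
             (trans (sym (Σ-+ (λ i → γ i * X i k) (λ i → - 1# * (μ i * X i k))))
             (trans (Σ-cong {m} (λ i → trans (solve 3 (λ g u x → g :* x :+ (:- :1) :* (u :* x) := (g :+ (:- :1) :* u) :* x)
                      refl (γ i) (μ i) (X i k)) (*-congʳ (sym (combination≈ i)))))
               (Subspace.sum (Dep-subspace X) μ (λ i j → β i j + - δ i j) (λ i → proj₂ (proj₂ (each i))) k)))) ⟩
      0# + Σ[ (λ i → μ i * X i k) ]
        ≈⟨ +-identityˡ _ ⟩
      Σ[ (λ i → μ i * X i k) ] ∎

  -- If `T` had fewer than `n` points, the coefficient rows of the `n` unit vectors would be
  -- dependent, and so would the unit vectors.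
  spanning-size : ∀ {n m} (X : Fin m → Vect F n) (T : Subset m) →
                  (∀ y → Σ (Coeffs m) λ γ → SupportedOn F T γ × (∀ k → Σ[ (λ i → γ i * X i k) ] ≈ y k)) →
                  ¬ (∣ T ∣ ℕ.< n)
  spanning-size {n} {m} X T span ∣T∣<n = contradict
    (underdetermined ∣ T ∣ (Subset.⊤ {n}) (λ k j → M j (e k)) (≡.subst (∣ T ∣ ℕ.<_) (≡.sym (∣⊤∣≡n n)) ∣T∣<n))
    where
    open import Relation.Binary.Reasoning.Setoid setoid
    e : Fin ∣ T ∣ → Fin m
    e = proj₁ (enumerate T)

    M : Fin n → Coeffs m
    M j = proj₁ (span (δ j))

    contradict : NontrivialSolution (Subset.⊤ {n}) (λ k j → M j (e k)) → ⊥
    contradict (x , _ , (q , xq≉0) , sol) = xq≉0 (begin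
      x q                                              ≈⟨ Σ-δʳ x q ⟨
      Σ[ (λ j → x j * δ j q) ]                         ≈⟨ Σ-cong {n} (λ j → *-congˡ (proj₂ (proj₂ (span (δ j))) q)) ⟨
      Σ[ (λ j → x j * Σ[ (λ i → M j i * X i q) ]) ]    ≈⟨ Σ-cong {n} (λ j → Σ-*ˡ (x j) (λ i → M j i * X i q)) ⟨
      Σ[ (λ j → Σ[ (λ i → x j * (M j i * X i q)) ]) ]  ≈⟨ Σ-swap (λ j i → x j * (M j i * X i q)) ⟩
      Σ[ (λ i → Σ[ (λ j → x j * (M j i * X i q)) ]) ]  ≈⟨ Σ-zero {m} column ⟩
      0#                                               ∎)
      where
      coefficient : ∀ i → Σ[ (λ j → x j * M j i) ] ≈ 0#
      coefficient i with i ∈? T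
      ... | no i∉T = Σ-zero {n} (λ j → trans (*-congˡ (proj₁ (proj₂ (span (δ j))) i i∉T)) (zeroʳ (x j)))
      ... | yes i∈T with proj₂ (enumerate T) i∈T
      ... | k , ≡.refl = sol k

      column : ∀ i → Σ[ (λ j → x j * (M j i * X i q)) ] ≈ 0#
      column i = trans (Σ-cong {n} (λ j → sym (*-assoc (x j) (M j i) (X i q))))
        (trans (Σ-*ʳ (λ j → x j * M j i) (X i q)) (trans (*-congʳ (coefficient i)) (zeroˡ _)))

  -- Whether a point lies in a given span is left undecided. The argument that consults this ends in
  -- a contradiction, where finite choice under double negation suffices.
  ¬¬-finite : ∀ {m p} {P : Fin m → Set p} → (∀ i → ¬ ¬ P i) → ¬ ¬ (∀ i → P i)
  ¬¬-finite {zero} h k = k λ ()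
  ¬¬-finite {suc m} h k = h zero λ p → ¬¬-finite (λ i → h (suc i)) λ ps → k λ { zero → p ; (suc i) → ps i }

  -- A positive multiple keeps the two negative entries and a negative multiple turns the two
  -- positive ones negative; only the zero multiple has fewer than two.
  ¬bad-scaled : ∀ {m} {α β : Coeffs m} s → BadSigns α → (∀ i → β i ≈ s * α i) →
                (∀ i j → i ≢ j → β i < 0# → β j < 0# → ⊥) → ∀ i → β i ≈ 0#
  ¬bad-scaled {α = α} {β} s ((p , q , p≢q , αp , αq) , (p′ , q′ , p′≢q′ , αp′ , αq′)) e no-two i with compare s 0#
  ... | tri< s<0 _ _ = ⊥-elim (no-two p q p≢q
    (<-respˡ-≈ (sym (e p)) (*-neg-pos s<0 αp)) (<-respˡ-≈ (sym (e q)) (*-neg-pos s<0 αq)))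
  ... | tri≈ _ s≈0 _ = trans (e i) (trans (*-congʳ s≈0) (zeroˡ _))
  ... | tri> _ _ s>0 = ⊥-elim (no-two p′ q′ p′≢q′
    (<-respˡ-≈ (sym (e p′)) (*-pos-neg s>0 αp′)) (<-respˡ-≈ (sym (e q′)) (*-pos-neg s>0 αq′)))

  -- Sets whose only relation has bad signs

  module _ {n m} (X : Fin m → Vect F n) {α : Coeffs m} (Dα : Dep X α) (bad : BadSigns α) where

    open Subspace (Dep-subspace X)

    record OnlyRelation (S : Subset m) : Set (c ⊔ ℓ₁) where
      field
        supported : SupportedOn F S α
        multiple : ∀ β → SupportedOn F S β → Dep X β → ∃[ s ] (∀ i → β i ≈ s * α i)

    -- A failure of either condition is a relation with at most one negative entry, so `¬bad-scaled`
    -- makes it zero; yet its entries sum to one in the first case, and it is minus one at `i` in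
    -- the second.
    conical : ∀ S → OnlyRelation S → ConicalPosition F X S
    conical S only = ∉hull , ∉cone
      where
      open OnlyRelation only
      ∉hull : ¬ InConvexHull F X S (zeroV F)
      ∉hull (μ , supp , μ≥0 , Σμ≈1 , Dμ) with multiple μ supp Dμ
      ... | s , e = 1≉0 (trans (sym Σμ≈1) (Σ-zero {m} (¬bad-scaled s bad e
        (λ i _ _ μi<0 _ → nonneg⇒≮0 (μ≥0 i) μi<0))))

      ∉cone : ∀ i → i ∈ S → ¬ InPositiveHull F X (S [ i ]≔ outside) (X i)
      ∉cone i i∈S (μ , supp , μ≥0 , μX≈Xi) = contradict (multiple β suppβ Dβ)
        where
        β : Coeffs m
        β j = μ j + - 1# * δ i j

        β-away : ∀ {j} → i ≢ j → β j ≈ μ j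
        β-away i≢j = trans (+-congˡ (trans (*-congˡ (δ-≢ i≢j)) (zeroʳ _))) (+-identityʳ _)

        suppβ : SupportedOn F S β
        suppβ j j∉S = trans (β-away (λ { ≡.refl → j∉S i∈S })) (supp j (∉-remove⁺ {S = S} j∉S))

        Dβ : Dep X β
        Dβ k = trans (Σ-perturb μ (- 1#) i (λ j → X j k)) (trans (+-congʳ (μX≈Xi k))
          (solve 1 (λ x → x :+ (:- :1) :* x := :0) refl (X i k)))

        no-two : ∀ p q → p ≢ q → β p < 0# → β q < 0# → ⊥
        no-two p q p≢q βp βq with i ≟ p
        ... | no i≢p = nonneg⇒≮0 (μ≥0 p) (<-respˡ-≈ (β-away i≢p) βp)
        ... | yes ≡.refl = nonneg⇒≮0 (μ≥0 q) (<-respˡ-≈ (β-away p≢q) βq)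

        contradict : ∃[ s ] (∀ j → β j ≈ s * α j) → ⊥
        contradict (s , e) = 1≉0 (trans (solve 0 (:1 := :- (:0 :+ (:- :1) :* :1)) refl)
          (trans (-‿cong (trans (+-cong (sym (supp i (∉-remove S i))) (*-congˡ (sym (δ-refl i))))
            (¬bad-scaled s bad e no-two i))) (solve 0 (:- :0 := :0) refl)))

    pivot : Fin m
    pivot = proj₁ (proj₁ bad)

    αpivot≉0 : ¬ (α pivot ≈ 0#)
    αpivot≉0 = pos⇒≉0 (proj₁ (proj₂ (proj₂ (proj₂ (proj₁ bad)))))

    pivot∈ : ∀ {S} → OnlyRelation S → pivot ∈ S
    pivot∈ {S} only = decidable-stable (pivot ∈? S) (λ p∉S → αpivot≉0 (OnlyRelation.supported only pivot p∉S))

    -- Without `pivot` the set is linearly independent: a multiple of `α` that vanishes at `pivot`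
    -- is zero.
    size≤ : ∀ S → OnlyRelation S → ∣ S ∣ ℕ.≤ suc n
    size≤ S only = ℕ.≮⇒≥ λ n+1<∣S∣ → contradict
      (underdetermined n (S [ pivot ]≔ outside) (λ k i → X i k)
        (ℕ.≤-pred (≡.subst (suc n ℕ.<_) (∣remove∣ (pivot∈ only)) n+1<∣S∣)))
      where
      open OnlyRelation only
      contradict : NontrivialSolution (S [ pivot ]≔ outside) (λ k i → X i k) → ⊥
      contradict (x , supp , (q , xq≉0) , Dx)
        with multiple x (λ i i∉S → supp i (∉-remove⁺ {S = S} i∉S)) Dx
      ... | s , e = xq≉0 (trans (e q) (trans (*-congʳ s≈0) (zeroˡ _)))
        where
        s≈0 : s ≈ 0#
        s≈0 = *-cancelʳ-0 αpivot≉0 (trans (sym (e pivot)) (supp pivot (∉-remove S pivot)))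

    InSpanOf : Subset m → Fin m → Set (c ⊔ ℓ₁)
    InSpanOf S i = Σ (Coeffs m) λ β → SupportedOn F S β × Dep X (λ j → β j + - δ i j)

    avoid-pivot : ∀ {S} → OnlyRelation S → ∀ {i} → InSpanOf S i → InSpanOf (S [ pivot ]≔ outside) i
    avoid-pivot {S} only {i} (β , supp , d) = β′ , supp′ ,
      resp (λ j → solve 4 (λ b d a α → (b :+ :- d) :+ (:- a) :* α := (b :+ :- (a :* α)) :+ :- d) refl
        (β j) (δ i j) a (α j)) (d ⊕ - a · Dα)
      where
      a : Carrier
      a = β pivot * α pivot ⁻¹

      β′ : Coeffs m
      β′ j = β j + - (a * α j)

      supp′ : SupportedOn F (S [ pivot ]≔ outside) β′
      supp′ j j∉ with j ≟ pivot
      ... | yes ≡.refl = trans (+-congˡ (-‿cong (trans (*-assoc _ _ _)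
        (trans (*-congˡ (⁻¹-inverseˡ αpivot≉0)) (*-identityʳ _))))) (-‿inverseʳ _)
      ... | no j≢p = trans
        (+-cong (supp j j∉S) (-‿cong (trans (*-congˡ (OnlyRelation.supported only j j∉S)) (zeroʳ a)))) (-‿inverseʳ 0#)
        where
        j∉S : j ∉ S
        j∉S = ∉-remove⁻ j≢p j∉

    -- A new relation created by inserting `i` would have a nonzero coefficient at `i` and could be
    -- solved for that point.
    ¬insert⇒inSpan : ∀ {S} → OnlyRelation S → ∀ i → ¬ (i ∉ S × OnlyRelation (S [ i ]≔ inside)) → ¬ ¬ InSpanOf S i
    ¬insert⇒inSpan {S} only i ¬insert ¬span with i ∈? S
    ... | yes i∈S = ¬span (δ i , (λ j j∉S → δ-≢ (λ { ≡.refl → j∉S i∈S })) ,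
      resp (λ j → sym (-‿inverseʳ _)) null)
    ... | no i∉S = ¬insert (i∉S , record { supported = λ j j∉ → supported j (⊆S′ j∉) ; multiple = multiple′ })
      where
      open OnlyRelation only

      ⊆S′ : ∀ {j} → j ∉ S [ i ]≔ inside → j ∉ S
      ⊆S′ {j} j∉ j∈S with j ≟ i
      ... | yes ≡.refl = i∉S j∈S
      ... | no j≢i = j∉ ([]≔-minimal S j i j≢i j∈S)

      multiple′ : ∀ β → SupportedOn F (S [ i ]≔ inside) β → Dep X β → ∃[ s ] (∀ j → β j ≈ s * α j)
      multiple′ β supp Dβ = multiple β supp′ Dβ
        where
        away : ∀ j → j ∉ S → j ≢ i → β j ≈ 0#
        away j j∉S j≢i = supp j (λ j∈ → j∉S (∈-update⁻ j≢i j∈))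

        solve-for-i : ¬ (β i ≈ 0#) → InSpanOf S i
        solve-for-i βi≉0 = (λ j → δ i j + - (β i ⁻¹ * β j)) , supp″ ,
          resp (λ j → solve 2 (λ d x → :0 :+ (:- :1) :* x := (d :+ :- x) :+ :- d) refl (δ i j) (β i ⁻¹ * β j))
            (null ⊕ - 1# · scale (β i ⁻¹) Dβ)
          where
          supp″ : SupportedOn F S (λ j → δ i j + - (β i ⁻¹ * β j))
          supp″ j j∉S with j ≟ i
          ... | yes ≡.refl = trans (+-cong (δ-refl i) (-‿cong (⁻¹-inverseˡ βi≉0))) (-‿inverseʳ 1#)
          ... | no j≢i = trans (+-cong (δ-≢ (λ e → j≢i (≡.sym e))) (-‿cong (trans (*-congˡ (away j j∉S j≢i)) (zeroʳ _))))
            (-‿inverseʳ 0#)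

        supp′ : SupportedOn F S β
        supp′ j j∉S with j ≟ i
        ... | no j≢i = away j j∉S j≢i
        ... | yes ≡.refl = decidable-stable (β i ≈? 0#) (λ βi≉0 → ¬span (solve-for-i βi≉0))

    -- If no point could be inserted, all would lie in the span of `S`, and hence of `S` without
    -- `pivot`, which has fewer than `n` points.
    insertable : Spanning X → ∀ S → OnlyRelation S → ∣ S ∣ ℕ.≤ n →
                 ¬ ¬ (∃[ i ] (i ∉ S × OnlyRelation (S [ i ]≔ inside)))
    insertable spanning S only ∣S∣≤n none =
      ¬¬-finite (λ i → ¬insert⇒inSpan only i (λ p → none (i , p))) λ all →
        spanning-size X (S [ pivot ]≔ outside)
          (respan X (λ i → avoid-pivot only (all i)) spanning)
          (≡.subst (ℕ._≤ n) (∣remove∣ (pivot∈ only)) ∣S∣≤n)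

    module _ (spanning : Spanning X) (noConical : ∀ S → ∣ S ∣ ≡ suc n → ¬ ConicalPosition F X S) where

      saturate : ∀ d S → OnlyRelation S → d ℕ.+ ∣ S ∣ ≡ suc n → ⊥
      saturate zero S only size = noConical S size (conical S only)
      saturate (suc d) S only size = insertable spanning S only ∣S∣≤n λ (i , i∉S , only′) →
        saturate d (S [ i ]≔ inside) only′
          (≡.trans (≡.cong (d ℕ.+_) (∣insert∣ S i i∉S)) (≡.trans (ℕ.+-suc d ∣ S ∣) size))
        where
        ∣S∣≤n : ∣ S ∣ ℕ.≤ n
        ∣S∣≤n = ≡.subst (∣ S ∣ ℕ.≤_) (ℕ.suc-injective size) (ℕ.m≤n+m ∣ S ∣ d)

  no-bad-circuit : ∀ {n m} (X : Fin m → Vect F n) → Spanning X →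
                   (∀ S → ∣ S ∣ ≡ suc n → ¬ ConicalPosition F X S) → NoBadCircuit (Dep X)
  no-bad-circuit {n} {m} X spanning noConical α (Dα , multiple) bad =
    saturate X Dα bad spanning noConical (suc n ℕ.∸ ∣ S ∣) S only (ℕ.m∸n+n≡m (size≤ X Dα bad S only))
    where
    support? : ∀ i → Dec (¬ (α i ≈ 0#))
    support? i = ¬? (α i ≈? 0#)

    S : Subset m
    S = comprehension support?

    only : OnlyRelation X Dα bad S
    only = record
      { supported = λ i i∉S → decidable-stable (α i ≈? 0#) (λ αi≉0 → i∉S (∈-comprehension⁺ support? αi≉0))
      ; multiple = λ β supp → multiple β (λ i αi≈0 → supp i (λ i∈S → ∈-comprehension⁻ support? i∈S αi≈0))
      }

  -- From the hypotheses to the skeleton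

  absolute : ∀ x → ∃[ a ] (0# ≤ a × 0# ≤ a + x × 0# ≤ a + - x)
  absolute x with neg-or-nonneg x
  ... | inj₁ x<0 = - x , inj₁ (neg⇒-pos x<0) , inj₂ (sym (-‿inverseˡ x)) , inj₁ (+-pos (neg⇒-pos x<0) (neg⇒-pos x<0))
  ... | inj₂ x≥0 = x , x≥0 , +-nonneg x≥0 x≥0 , inj₂ (sym (-‿inverseʳ x))

  bounded : ∀ {n} (y : Coeffs n) → ∃[ M ] (0# < M × (∀ j → 0# < M + y j × 0# < M + - y j))
  bounded {zero} y = 1# , 0<1 , λ ()
  bounded {suc n} y with bounded (λ j → y (suc j)) | absolute (y zero)
  ... | M , M>0 , below | a , a≥0 , a+y≥0 , a-y≥0 = M + a , +-pos-nonneg M>0 a≥0 , λ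
    { zero → <-respʳ-≈ (sym (+-assoc M a _)) (+-pos-nonneg M>0 a+y≥0) ,
             <-respʳ-≈ (sym (+-assoc M a _)) (+-pos-nonneg M>0 a-y≥0)
    ; (suc j) → <-respʳ-≈ (swap _) (+-pos-nonneg (proj₁ (below j)) a≥0) ,
                <-respʳ-≈ (swap _) (+-pos-nonneg (proj₂ (below j)) a≥0) }
    where
    swap : ∀ x → (M + x) + a ≈ (M + a) + x
    swap x = solve 3 (λ M x a → (M :+ x) :+ a := (M :+ a) :+ x) refl M x a

  module _ {n m} (X : Fin m → Vect F n) (interior : ZeroInInteriorConvHull F X) where

    -- Shrink `y` into the box around `0`, take convex coefficients there and scale back. As `M`
    -- exceeds all entries of `y` in absolute value, the factor `t` is small enough.
    positive-span : ∀ (y : Vect F n) → Σ (Coeffs m) λ μ → (∀ i → 0# ≤ μ i) × (∀ k → Σ[ (λ i → μ i * X i k) ] ≈ y k)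
    positive-span y = rescale (proj₂ (proj₂ interior) (λ j → t * y j) inBox)
      where
      open import Relation.Binary.Reasoning.Setoid setoid
      ε M t : Carrier
      ε = proj₁ interior
      M = proj₁ (bounded y)
      t = ε * M ⁻¹

      M>0 : 0# < M
      M>0 = proj₁ (proj₂ (bounded y))

      t>0 : 0# < t
      t>0 = *-pos (proj₁ (proj₂ interior)) (⁻¹-pos M>0)

      tM≈ε : t * M ≈ ε
      tM≈ε = trans (*-assoc _ _ _) (trans (*-congˡ (⁻¹-inverseˡ (pos⇒≉0 M>0))) (*-identityʳ ε))

      inBox : ∀ j → (- ε < t * y j) × (t * y j < ε)
      inBox j =
        0<-⇒< (<-respʳ-≈ (trans (solve 3 (λ t M y → t :* (M :+ y) := t :* y :+ :- (:- (t :* M))) refl t M (y j))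
          (+-congˡ (-‿cong (-‿cong tM≈ε)))) (*-pos t>0 (proj₁ (proj₂ (proj₂ (bounded y)) j)))) ,
        0<-⇒< (<-respʳ-≈ (trans (solve 3 (λ t M y → t :* (M :+ :- y) := t :* M :+ :- (t :* y)) refl t M (y j))
          (+-congʳ tM≈ε)) (*-pos t>0 (proj₂ (proj₂ (proj₂ (bounded y)) j))))

      rescale : InConvexHull F X _ (λ j → t * y j) →
                Σ (Coeffs m) λ μ → (∀ i → 0# ≤ μ i) × (∀ k → Σ[ (λ i → μ i * X i k) ] ≈ y k)
      rescale (μ , _ , μ≥0 , _ , e) = (λ i → t ⁻¹ * μ i) , (λ i → *-nonneg (inj₁ (⁻¹-pos t>0)) (μ≥0 i)) , λ k → begin
        Σ[ (λ i → t ⁻¹ * μ i * X i k) ]    ≈⟨ Σ-cong {m} (λ i → *-assoc (t ⁻¹) (μ i) (X i k)) ⟩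
        Σ[ (λ i → t ⁻¹ * (μ i * X i k)) ]  ≈⟨ Σ-*ˡ (t ⁻¹) (λ i → μ i * X i k) ⟩
        t ⁻¹ * Σ[ (λ i → μ i * X i k) ]    ≈⟨ *-congˡ (e k) ⟩
        t ⁻¹ * (t * y k)                   ≈⟨ *-assoc _ _ _ ⟨
        t ⁻¹ * t * y k                     ≈⟨ *-congʳ (⁻¹-inverseˡ (pos⇒≉0 t>0)) ⟩
        1# * y k                           ≈⟨ *-identityˡ _ ⟩
        y k                                ∎

    spanning : Spanning X
    spanning y = proj₁ (positive-span y) , proj₂ (proj₂ (positive-span y))

    -- Represent minus the sum of all points with nonnegative coefficients, then add each point
    -- once.
    strictly-positive : StrictlyPositive (Dep X)
    strictly-positive = (λ i → 1# + μ i) , (λ i → +-pos-nonneg 0<1 (proj₁ (proj₂ minus-sum) i)) , λ k → begin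
      Σ[ (λ i → (1# + μ i) * X i k) ]                  ≈⟨ Σ-cong {m} (λ i → solve 2
        (λ u x → (:1 :+ u) :* x := x :+ u :* x) refl (μ i) (X i k)) ⟩
      Σ[ (λ i → X i k + μ i * X i k) ]                 ≈⟨ Σ-+ (λ i → X i k) (λ i → μ i * X i k) ⟩
      Σ[ (λ i → X i k) ] + Σ[ (λ i → μ i * X i k) ]    ≈⟨ +-congˡ (proj₂ (proj₂ minus-sum) k) ⟩
      Σ[ (λ i → X i k) ] + - Σ[ (λ i → X i k) ]        ≈⟨ -‿inverseʳ _ ⟩
      0#                                               ∎
      where
      open import Relation.Binary.Reasoning.Setoid setoid
      minus-sum : Σ (Coeffs m) λ μ → (∀ i → 0# ≤ μ i) × (∀ k → Σ[ (λ i → μ i * X i k) ] ≈ - Σ[ (λ i → X i k) ])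
      minus-sum = positive-span (λ k → - Σ[ (λ i → X i k) ])

      μ : Coeffs m
      μ = proj₁ minus-sum

  -- From coefficients to the simplices of a skeleton

  module Assemble {n m} (X : Fin m → Vect F n) (i₀ : Fin m) (nonzero : ∀ i → ¬ (_≈ᵥ_ F (X i) (zeroV F)))
    (X-spans : Spanning X) (skeletal : Skeletal (Dep X)) where

    open Skeletal skeletal
    open Subspace (Dep-subspace X)

    Inhabited : Fin m → Set ℓ₂
    Inhabited a = ∃[ j ] (lab j ≡ a × 0# < w j)

    inhabited? : ∀ a → Dec (Inhabited a)
    inhabited? a = any? (λ j → lab j ≟ a ×-dec 0# <? w j)

    k : ℕ
    k = proj₁ (select inhabited?)

    e : Fin k → Fin m
    e = proj₁ (proj₂ (select inhabited?))

    e-injective : ∀ a b → e a ≡ e b → a ≡ b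
    e-injective = proj₁ (proj₂ (proj₂ (select inhabited?)))

    e-inhabited : ∀ a → Inhabited (e a)
    e-inhabited = proj₁ (proj₂ (proj₂ (proj₂ (select inhabited?))))

    e-complete : ∀ i → Inhabited i → ∃[ a ] (e a ≡ i)
    e-complete = proj₂ (proj₂ (proj₂ (proj₂ (select inhabited?))))

    member? : ∀ a j → Dec (lab j ≡ e a × 0# < w j)
    member? a j = lab j ≟ e a ×-dec 0# <? w j

    Y : Fin k → Subset m
    Y a = comprehension (member? a)

    Y⁻ : ∀ {a j} → j ∈ Y a → lab j ≡ e a × 0# < w j
    Y⁻ {a} = ∈-comprehension⁻ (member? a)

    unsupported : ∀ {i} a → w i ≈ 0# → i ∉ Y a
    unsupported a wi≈0 i∈Y = pos⇒≉0 (proj₂ (Y⁻ i∈Y)) wi≈0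

    disjoint : ∀ a b → a ≢ b → ∀ i → i ∈ Y a → i ∉ Y b
    disjoint a b a≢b i i∈a i∈b = a≢b (e-injective a b (≡.trans (≡.sym (proj₁ (Y⁻ i∈a))) (proj₁ (Y⁻ i∈b))))

    outside-block : ∀ a {i} → i ∉ Y a → δ (e a) (lab i) ≈ 0# ⊎ w i ≈ 0#
    outside-block a {i} i∉ with e a ≟ lab i | w≥0 i
    ... | no p | _ = inj₁ (δ-≢ p)
    ... | yes _ | inj₂ q = inj₂ (sym q)
    ... | yes p | inj₁ q = ⊥-elim (i∉ (∈-comprehension⁺ (member? a) (≡.sym p , q)))

    localize : Fin k → Coeffs m → Coeffs m
    localize a γ i = δ (e a) (lab i) * γ i

    localize-supp : ∀ a {γ} → Supp γ w → SupportedOn F (Y a) (localize a γ)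
    localize-supp a supp i i∉ with outside-block a i∉
    ... | inj₁ p = trans (*-congʳ p) (zeroˡ _)
    ... | inj₂ p = trans (*-congˡ (supp i p)) (zeroʳ _)

    localize-inside : ∀ {a i} γ → i ∈ Y a → localize a γ i ≈ γ i
    localize-inside γ i∈ = trans (*-congʳ (δ-≡ (≡.sym (proj₁ (Y⁻ i∈))))) (*-identityˡ _)

    D-localize : ∀ a → Dep X (localize a w)
    D-localize a = closed (δ (e a))

    localize-≥0 : ∀ a i → 0# ≤ localize a w i
    localize-≥0 a i = *-nonneg (δ-nonneg (e a) (lab i)) (w≥0 i)

    localize->0 : ∀ {a i} → i ∈ Y a → 0# < localize a w i
    localize->0 i∈ = <-respʳ-≈ (sym (localize-inside w i∈)) (proj₂ (Y⁻ i∈))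

    mass : Fin k → Carrier
    mass a = Σ[ localize a w ]

    mass>0 : ∀ a → 0# < mass a
    mass>0 a with e-inhabited a
    ... | j , p = Σ-pos (localize-≥0 a) j (localize->0 (∈-comprehension⁺ (member? a) p))

    proportional-on-block : ∀ a {γ : Coeffs m} (t : Coeffs m) → SupportedOn F (Y a) γ →
      (∀ i → i ∈ Y a → γ i ≈ t (lab i) * w i) → ∀ i → γ i ≈ t (e a) * localize a w i
    proportional-on-block a t supp h i with member? a i
    ... | no p = trans (supp i i∉) (sym (trans (*-congˡ (localize-supp a (λ _ q → q) i i∉)) (zeroʳ _)))
      where
      i∉ : i ∉ Y a
      i∉ q = p (Y⁻ q)
    ... | yes p = trans (h i i∈) (*-cong (reflexive (≡.cong t (proj₁ p))) (sym (localize-inside w i∈)))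
      where
      i∈ : i ∈ Y a
      i∈ = ∈-comprehension⁺ (member? a) p

    simplex : ∀ a → SimplexWith0InRelint F X (Y a)
    simplex a = independent , (λ i → mass a ⁻¹ * localize a w i) ,
      (λ i i∉ → trans (*-congˡ (localize-supp a (λ _ q → q) i i∉)) (zeroʳ _)) ,
      (λ i i∈ → *-pos (⁻¹-pos (mass>0 a)) (localize->0 i∈)) ,
      trans (Σ-*ˡ (mass a ⁻¹) (localize a w)) (⁻¹-inverseˡ (pos⇒≉0 (mass>0 a))) ,
      scale {localize a w} (mass a ⁻¹) (D-localize a)
      where
      independent : AffinelyIndependent F X (Y a)
      independent γ supp Σγ≈0 Dγ = vanish (rigid γ (λ i p → supp i (unsupported a p)) Dγ)
        where
        vanish : (Σ (Coeffs m) λ t → ∀ i → γ i ≈ t (lab i) * w i) → ∀ i → γ i ≈ 0#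
        vanish (t , h) i = trans (γ≈ i) (trans (*-congʳ t≈0) (zeroˡ _))
          where
          γ≈ : ∀ i → γ i ≈ t (e a) * localize a w i
          γ≈ = proportional-on-block a t supp (λ i _ → h i)

          -- The entries of `γ` sum to `t (e a)` times the positive `mass a`.
          t≈0 : t (e a) ≈ 0#
          t≈0 = *-cancelʳ-0 (pos⇒≉0 (mass>0 a))
            (trans (sym (Σ-*ˡ (t (e a)) (localize a w))) (trans (sym (Σ-cong {m} γ≈)) Σγ≈0))

    -- Added up, the coefficients of all `v a` form one relation on the vertices. By `rigid` it is a
    -- multiple of `w` on each block, and such a multiple represents the zero vector.
    independent : ∀ (v : Fin k → Vect F n) → (∀ a → InSpan F X (Y a) (v a)) →
                  (∀ j → Σ[ (λ a → v a j) ] ≈ 0#) → ∀ a j → v a j ≈ 0#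
    independent v inSpan Σv≈0 a j = vanish (rigid total supp Dtotal)
      where
      γ : Fin k → Coeffs m
      γ b = proj₁ (inSpan b)

      total : Coeffs m
      total i = Σ[ (λ b → γ b i) ]

      supp : Supp total w
      supp i p = Σ-zero {k} (λ b → proj₁ (proj₂ (inSpan b)) i (unsupported b p))

      Dtotal : Dep X total
      Dtotal l = trans (Σ-cong {m} (λ i → sym (Σ-*ʳ (λ b → γ b i) (X i l))))
        (trans (Σ-swap (λ i b → γ b i * X i l))
          (trans (Σ-cong {k} (λ b → proj₂ (proj₂ (inSpan b)) l)) (Σv≈0 l)))

      total-inside : ∀ i → i ∈ Y a → total i ≈ γ a i
      total-inside i i∈ = Σ-single a (λ b b≢a →
        proj₁ (proj₂ (inSpan b)) i (disjoint a b (λ p → b≢a (≡.sym p)) i i∈))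

      vanish : (Σ (Coeffs m) λ t → ∀ i → total i ≈ t (lab i) * w i) → v a j ≈ 0#
      vanish (t , h) = trans (sym (proj₂ (proj₂ (inSpan a)) j)) (resp
        (λ i → sym (proportional-on-block a t (proj₁ (proj₂ (inSpan a)))
          (λ i i∈ → trans (sym (total-inside i i∈)) (h i)) i))
        (scale {localize a w} (t (e a)) (D-localize a)) j)

    blocks-span : ∀ (y : Vect F n) → Σ (Fin k → Vect F n) λ v →
                  (∀ a → InSpan F X (Y a) (v a)) × (∀ j → Σ[ (λ a → v a j) ] ≈ y j)
    blocks-span y = split (respan X span X-spans y)
      where
      open import Relation.Binary.Reasoning.Setoid setoid
      split : (Σ (Coeffs m) λ γ → Supp γ w × (∀ l → Σ[ (λ i → γ i * X i l) ] ≈ y l)) → _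
      split (γ , supp , γX≈y) = (λ a → lincomb F X (localize a γ)) ,
        (λ a → localize a γ , localize-supp a supp , λ _ → refl) , λ l → begin
          Σ[ (λ a → Σ[ (λ i → localize a γ i * X i l) ]) ]  ≈⟨ Σ-swap (λ a i → localize a γ i * X i l) ⟩
          Σ[ (λ i → Σ[ (λ a → localize a γ i * X i l) ]) ]  ≈⟨ Σ-cong {m} (λ i → trans (Σ-*ʳ (λ a → localize a γ i) (X i l)) (*-congʳ (total i))) ⟩
          Σ[ (λ i → γ i * X i l) ]                          ≈⟨ γX≈y l ⟩
          y l                                               ∎
        where
        total : ∀ i → Σ[ (λ a → localize a γ i) ] ≈ γ i
        total i with w≥0 i
        ... | inj₂ p = trans (Σ-zero {k} (λ a → trans (*-congˡ (supp i (sym p))) (zeroʳ _))) (sym (supp i (sym p)))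
        ... | inj₁ p with e-complete (lab i) (i , ≡.refl , p)
        ... | a , q = trans (Σ-single a (λ b b≢a → trans
                (*-congʳ (δ-≢ (λ r → b≢a (e-injective b a (≡.trans r (≡.sym q)))))) (zeroˡ _)))
              (trans (*-congʳ (δ-≡ q)) (*-identityˡ _))

    -- With no blocks, `blocks-span` would write `X i₀` as an empty sum.
    k≢0 : k ≢ 0
    k≢0 k≡0 = nonzero i₀ (λ j → trans (sym (proj₂ (proj₂ (blocks-span (X i₀))) j))
      (empty k≡0 (λ a → proj₁ (blocks-span (X i₀)) a j)))
      where
      empty : ∀ {k} → k ≡ 0 → (f : Coeffs k) → Σ[ f ] ≈ 0#
      empty ≡.refl f = refl

    skeleton : Skeleton F X k Y
    skeleton = record
      { k≥1 = ℕ.n≢0⇒n>0 k≢0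
      ; disjoint = disjoint
      ; simplices = simplex
      ; independent = independent
      ; spanning = blocks-span
      }

  -- The hull of an empty family is empty, since its coefficients would sum to `0#` instead of `1#`.
  inhabited : ∀ {n m} (X : Fin m → Vect F n) → ZeroInInteriorConvHull F X → Fin m
  inhabited {m = suc m} X interior = zero
  inhabited {m = zero} X (ε , ε>0 , inHull)
    with inHull (λ _ → 0#) (λ _ → pos⇒-neg ε>0 , ε>0)
  ... | _ , _ , _ , 0≈1 , _ = ⊥-elim (1≉0 (sym 0≈1))

  has-skeleton-family : ∀ {n m} (X : Fin m → Vect F n) → Hypotheses F X →
                        ∃[ k ] Σ (Fin k → Subset m) (Skeleton F X k)
  has-skeleton-family {n} {m} X hyp = k , Y , skeleton
    where
    open Hypotheses hyp
    open Assemble X (inhabited X interior) nonzero (spanning X interior)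
      (has-skeleton n m X (no-bad-circuit X (spanning X interior) noConical) (strictly-positive X interior))

theorem3 : ∀ {c ℓ₁ ℓ₂ : Level} (F : OrderedField c ℓ₁ ℓ₂) (n m : ℕ)
    (X : Fin m → Vect F n) → Hypotheses F X
    → ∃[ k ] ∃[ Y ] Skeleton F X k Y
theorem3 F n m X = has-skeleton-family F X
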